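{- If $\mathcal A$ is an arrangement of $n$ hyperplanes of rank $r$ in a finite-dimensional complex vector space $V$, then $$\mathrm{Hilb}(C_{\mathcal A,0};q)=q^{n-r}\,T_{\mathcal A}\!\left(1+q,\frac1q\right).$$
   Context: $\mathbb C[V^*]$ denotes the algebra of polynomial functions on $V$. A (central) arrangement $\mathcal A=\{H_1,\dots,H_n\}$ in $V$ is a finite list (repetitions allowed) of hyperplanes $H_i=\{l_i=0\}$ with $l_i\in V^*$; the degenerate case $l_i=0$ (a loop) is allowed. Its matroid is the linear matroid of $l_1,\dots,l_n$ with rank function $r(\cdot)$; the rank of $\mathcal A$ is $r=\dim\mathrm{span}(l_1,\dots,l_n)$. For nonzero $h\in V$, $\rho_{\mathcal A}(h)$ is the number of $i$ with $l_i(h)\neq 0$. $C_{\mathcal A,0}$ is the space of $f\in\mathbb C[V^*]$ such that for every nonzero $h\in V$ the restriction of $f$ to every affine line of direction $h$ has degree at most $\rho_{\mathcal A}(h)$; it is finite-dimensional and graded by degree, and $\mathrm{Hilb}(C;q)=\sum_i \dim C_i\,q^i$. The Tutte polynomial is $T_{\mathcal A}(x,y)=\sum_{S\subseteq[n]}(x-1)^{r-r(S)}(y-1)^{|S|-r(S)}$. -}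

module Defs where

open import Algebra.Bundles using (CommutativeRing; RawRing)
import Algebra.Construct.Pointwise as Pointwise
import Algebra.Definitions.RawMonoid as RawMonoidDefs
import Algebra.Definitions.RawSemiring as RawSemiringDefs
open import Algebra.Module.Bundles using (Module)
import Algebra.Module.Construct.TensorUnit as TensorUnit
open import Algebra.Module.Morphism.Structures using (module ModuleMorphisms)
open import Algebra.Module.Structures.Biased using (IsModuleFromLeft)
open import Algebra.Properties.Ring using (-1*x≈-x)
import Algebra.Solver.Ring.NaturalCoefficients.Default as SemiringSolver
open import Axiom.ExcludedMiddle using (ExcludedMiddle)
open import Data.Bool.Base using (if_then_else_)
open import Data.Fin.Base using (Fin; toℕ)
open import Data.Fin.Subset using (Subset; inside; outside; _⊆_; _∉_; ∣_∣)
open import Data.Integer.Base as ℤ using (ℤ; +_)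
import Data.Integer.Properties as ℤ
open import Data.List.Base as List using (List; []; _∷_; _++_)
open import Data.List.Extrema.Nat using (max)
open import Data.Nat.Base as ℕ using (ℕ; zero; suc; _∸_)
import Data.Nat.Properties as ℕ
open import Data.Product.Base using (Σ-syntax; ∃-syntax; _×_; _,_)
open import Data.Rational.Base as ℚ using (ℚ; 0ℚ; 1ℚ)
import Data.Rational.Properties as ℚ
import Data.Rational.Solver as ℚSolver
open import Data.Vec.Base as Vec using ()
open import Data.Vec.Functional using (Vector)
open import Level using (Level; 0ℓ; _⊔_)
open import Relation.Binary.PropositionalEquality
  using (_≡_; refl; sym; trans; cong; cong₂; subst)
open import Relation.Nullary.Decidable.Core using (does)
open import Relation.Nullary.Negation.Core using (¬_)
open import Relation.Unary using (Pred; U)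

-- The reals are Cauchy sequences of rationals modulo null sequences.

Cauchy : (ℕ → ℚ) → Set
Cauchy x = ∀ ε → 0ℚ ℚ.< ε → ∃[ N ] ∀ m n → N ℕ.≤ m → N ℕ.≤ n → ℚ.∣ x m ℚ.- x n ∣ ℚ.< ε

record ℝ : Set where
  constructor mkℝ
  field
    seq    : ℕ → ℚ
    cauchy : Cauchy seq
open ℝ public

-- The equalities on ℝ and ℂ are records, not functions, so that unification
-- recovers the two sides.
infix 4 _≈ℝ_
record _≈ℝ_ (x y : ℝ) : Set where
  constructor mk≈
  field
    close : ∀ ε → 0ℚ ℚ.< ε → ∃[ N ] ∀ n → N ℕ.≤ n → ℚ.∣ seq x n ℚ.- seq y n ∣ ℚ.< ε
open _≈ℝ_ public

module NullSequences where
  -- Double sequences with limit 0, covering both Cauchy and _≈ℝ_.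
  Null : (ℕ → ℕ → ℚ) → Set
  Null u = ∀ ε → 0ℚ ℚ.< ε → ∃[ N ] ∀ m n → N ℕ.≤ m → N ℕ.≤ n → ℚ.∣ u m n ∣ ℚ.< ε

  Δ : (ℕ → ℚ) → ℕ → ℕ → ℚ
  Δ x m n = x m ℚ.- x n

  dist : ℝ → ℝ → ℕ → ℕ → ℚ
  dist x y m _ = seq x m ℚ.- seq y m

  ≈⇒null : ∀ x y → x ≈ℝ y → Null (dist x y)
  ≈⇒null x y x≈y ε 0<ε = let N , p = close x≈y ε 0<ε in N , λ m _ N≤m _ → p m N≤m

  null⇒≈ : ∀ x y → Null (dist x y) → x ≈ℝ y
  null⇒≈ x y z = mk≈ λ ε 0<ε → let N , p = z ε 0<ε in N , λ n N≤n → p n n N≤n N≤n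

  null-cong : ∀ u v → (∀ m n → u m n ≡ v m n) → Null u → Null v
  null-cong u v u≡v z ε 0<ε = let N , p = z ε 0<ε in
    N , λ m n N≤m N≤n → subst (λ a → ℚ.∣ a ∣ ℚ.< ε) (u≡v m n) (p m n N≤m N≤n)

  null-0 : Null (λ _ _ → 0ℚ)
  null-0 ε 0<ε = 0 , λ _ _ _ _ → 0<ε

  null-neg : ∀ u → Null u → Null (λ m n → ℚ.- u m n)
  null-neg u z ε 0<ε = let N , p = z ε 0<ε in
    N , λ m n N≤m N≤n → subst (ℚ._< ε) (sym (ℚ.∣-p∣≡∣p∣ (u m n))) (p m n N≤m N≤n)

  null-+ : ∀ u v → Null u → Null v → Null (λ m n → u m n ℚ.+ v m n)
  null-+ u v y z ε 0<ε =
    let N , p = y (ℚ.½ ℚ.* ε) 0<½ε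
        M , q = z (ℚ.½ ℚ.* ε) 0<½ε
    in N ℕ.⊔ M , λ m n a b →
      subst (ℚ.∣ u m n ℚ.+ v m n ∣ ℚ.<_) halves
        (ℚ.≤-<-trans (ℚ.∣p+q∣≤∣p∣+∣q∣ (u m n) (v m n))
          (ℚ.+-mono-<
            (p m n (ℕ.≤-trans (ℕ.m≤m⊔n N M) a) (ℕ.≤-trans (ℕ.m≤m⊔n N M) b))
            (q m n (ℕ.≤-trans (ℕ.m≤n⊔m N M) a) (ℕ.≤-trans (ℕ.m≤n⊔m N M) b))))
    where
    0<½ε : 0ℚ ℚ.< ℚ.½ ℚ.* ε
    0<½ε = subst (ℚ._< ℚ.½ ℚ.* ε) (ℚ.*-zeroʳ ℚ.½) (ℚ.*-monoʳ-<-pos ℚ.½ 0<ε)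
    halves : ℚ.½ ℚ.* ε ℚ.+ ℚ.½ ℚ.* ε ≡ ε
    halves = trans (sym (ℚ.*-distribʳ-+ ε ℚ.½ ℚ.½)) (ℚ.*-identityˡ ε)

  Bounded : (ℕ → ℚ) → Set
  Bounded b = Σ[ B ∈ ℚ ] ℚ.Positive B × (∃[ N ] ∀ n → N ℕ.≤ n → ℚ.∣ b n ∣ ℚ.≤ B)

  cauchy⇒bounded : ∀ x → Cauchy x → Bounded x
  cauchy⇒bounded x c =
    let N , p = c 1ℚ (ℚ.positive⁻¹ 1ℚ)
        B = 1ℚ ℚ.+ ℚ.∣ x N ∣
    in B , ℚ.pos+nonNeg⇒pos 1ℚ ℚ.∣ x N ∣ {{ℚ.∣-∣-nonNeg (x N)}} , N , λ n N≤n →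
      subst (λ a → ℚ.∣ a ∣ ℚ.≤ B) (split (x n) (x N))
        (ℚ.≤-trans (ℚ.∣p+q∣≤∣p∣+∣q∣ (x n ℚ.- x N) (x N))
          (ℚ.+-monoˡ-≤ ℚ.∣ x N ∣ (ℚ.<⇒≤ (p n N N≤n ℕ.≤-refl))))
    where
    open ℚSolver.+-*-Solver
    split : ∀ a b → (a ℚ.- b) ℚ.+ b ≡ a
    split = solve 2 (λ a b → (a :- b) :+ b := a) refl

  null-* : ∀ b u (k : ℕ → ℕ → ℕ) → (∀ {N} m n → N ℕ.≤ m → N ℕ.≤ n → N ℕ.≤ k m n) →
           Bounded b → Null u → Null (λ m n → b (k m n) ℚ.* u m n)
  null-* b u k k-large (B , B>0 , M , bound) z ε 0<ε =
    let instance _ = B>0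
                 _ = ℚ.pos⇒nonZero B
                 _ = ℚ.1/pos⇒pos B
                 _ = ℚ.pos⇒nonNeg B
        ε′ = (ℚ.1/ B) ℚ.* ε
        0<ε′ = subst (ℚ._< ε′) (ℚ.*-zeroʳ (ℚ.1/ B)) (ℚ.*-monoʳ-<-pos (ℚ.1/ B) 0<ε)
        Bε′≡ε = trans (sym (ℚ.*-assoc B (ℚ.1/ B) ε))
                  (trans (cong (ℚ._* ε) (ℚ.*-inverseʳ B)) (ℚ.*-identityˡ ε))
        N , p = z ε′ 0<ε′
    in N ℕ.⊔ M , λ m n s t →
      let instance _ = ℚ.∣-∣-nonNeg (u m n) in
      subst (ℚ._< ε) (sym (ℚ.∣p*q∣≡∣p∣*∣q∣ (b (k m n)) (u m n)))
        (ℚ.≤-<-trans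
          (ℚ.*-monoʳ-≤-nonNeg ℚ.∣ u m n ∣
            (bound (k m n) (k-large m n (ℕ.≤-trans (ℕ.m≤n⊔m N M) s) (ℕ.≤-trans (ℕ.m≤n⊔m N M) t))))
          (subst (B ℚ.* ℚ.∣ u m n ∣ ℚ.<_) Bε′≡ε
            (ℚ.*-monoʳ-<-pos B
              (p m n (ℕ.≤-trans (ℕ.m≤m⊔n N M) s) (ℕ.≤-trans (ℕ.m≤m⊔n N M) t)))))

  fst-large : ∀ {N} m n → N ℕ.≤ m → N ℕ.≤ n → N ℕ.≤ m
  fst-large _ _ N≤m _ = N≤m

  snd-large : ∀ {N} m n → N ℕ.≤ m → N ℕ.≤ n → N ℕ.≤ n
  snd-large _ _ _ N≤n = N≤n

  -- Used both for products of Cauchy sequences and for congruence of _*ℝ_.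
  product-diff : ∀ a b c d → a ℚ.* (b ℚ.- d) ℚ.+ d ℚ.* (a ℚ.- c) ≡ a ℚ.* b ℚ.- c ℚ.* d
  product-diff = solve 4 (λ a b c d →
    a :* (b :- d) :+ d :* (a :- c) := a :* b :- c :* d) refl
    where open ℚSolver.+-*-Solver

  sum-diff : ∀ a b c d → (a ℚ.- c) ℚ.+ (b ℚ.- d) ≡ (a ℚ.+ b) ℚ.- (c ℚ.+ d)
  sum-diff = solve 4 (λ a b c d → (a :- c) :+ (b :- d) := (a :+ b) :- (c :+ d)) refl
    where open ℚSolver.+-*-Solver

  neg-diff : ∀ a b → ℚ.- (a ℚ.- b) ≡ (ℚ.- a) ℚ.- (ℚ.- b)
  neg-diff = solve 2 (λ a b → :- (a :- b) := (:- a) :- (:- b)) refl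
    where open ℚSolver.+-*-Solver

private open module NS = NullSequences

-- Abstract, so that comparing two reals does not unfold the Cauchy proofs.
abstract
  const-cauchy : ∀ a → Cauchy (λ _ → a)
  const-cauchy a = null-cong (λ _ _ → 0ℚ) _ (λ _ _ → sym (ℚ.+-inverseʳ a)) null-0

  +-cauchy : ∀ x y → Cauchy x → Cauchy y → Cauchy (λ n → x n ℚ.+ y n)
  +-cauchy x y cx cy =
    null-cong (λ m n → Δ x m n ℚ.+ Δ y m n) (Δ (λ n → x n ℚ.+ y n))
      (λ m n → sum-diff (x m) (y m) (x n) (y n))
      (null-+ (Δ x) (Δ y) cx cy)

  neg-cauchy : ∀ x → Cauchy x → Cauchy (λ n → ℚ.- x n)
  neg-cauchy x cx =
    null-cong (λ m n → ℚ.- Δ x m n) (Δ (λ n → ℚ.- x n))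
      (λ m n → neg-diff (x m) (x n))
      (null-neg (Δ x) cx)

  *-cauchy : ∀ x y → Cauchy x → Cauchy y → Cauchy (λ n → x n ℚ.* y n)
  *-cauchy x y cx cy =
    null-cong (λ m n → x m ℚ.* Δ y m n ℚ.+ y n ℚ.* Δ x m n) (Δ (λ n → x n ℚ.* y n))
      (λ m n → product-diff (x m) (y m) (x n) (y n))
      (null-+ (λ m n → x m ℚ.* Δ y m n) (λ m n → y n ℚ.* Δ x m n)
        (null-* x (Δ y) (λ m _ → m) fst-large (cauchy⇒bounded x cx) cy)
        (null-* y (Δ x) (λ _ n → n) snd-large (cauchy⇒bounded y cy) cx))

constℝ : ℚ → ℝ
constℝ a = mkℝ (λ _ → a) (const-cauchy a)

infixl 6 _+ℝ_
infixl 7 _*ℝ_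
infix  8 -ℝ_

_+ℝ_ : ℝ → ℝ → ℝ
mkℝ x cx +ℝ mkℝ y cy = mkℝ (λ n → x n ℚ.+ y n) (+-cauchy x y cx cy)

-ℝ_ : ℝ → ℝ
-ℝ mkℝ x cx = mkℝ (λ n → ℚ.- x n) (neg-cauchy x cx)

_*ℝ_ : ℝ → ℝ → ℝ
mkℝ x cx *ℝ mkℝ y cy = mkℝ (λ n → x n ℚ.* y n) (*-cauchy x y cx cy)

private
  ptwise : ∀ x y → (∀ n → seq x n ≡ seq y n) → x ≈ℝ y
  ptwise x y x≡y = null⇒≈ x y (null-cong (λ _ _ → 0ℚ) (dist x y)
    (λ m _ → trans (sym (ℚ.+-inverseʳ (seq x m))) (cong (λ a → seq x m ℚ.- a) (x≡y m)))
    null-0)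

  ≈ℝ-sym : ∀ x y → x ≈ℝ y → y ≈ℝ x
  ≈ℝ-sym x y x≈y = null⇒≈ y x
    (null-cong (λ m n → ℚ.- dist x y m n) (dist y x)
      (λ m _ → lemma (seq x m) (seq y m))
      (null-neg (dist x y) (≈⇒null x y x≈y)))
    where
    open ℚSolver.+-*-Solver
    lemma : ∀ a b → ℚ.- (a ℚ.- b) ≡ b ℚ.- a
    lemma = solve 2 (λ a b → :- (a :- b) := b :- a) refl

  ≈ℝ-trans : ∀ x y z → x ≈ℝ y → y ≈ℝ z → x ≈ℝ z
  ≈ℝ-trans x y z x≈y y≈z = null⇒≈ x z
    (null-cong (λ m n → dist x y m n ℚ.+ dist y z m n) (dist x z)
      (λ m _ → lemma (seq x m) (seq y m) (seq z m))
      (null-+ (dist x y) (dist y z) (≈⇒null x y x≈y) (≈⇒null y z y≈z)))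
    where
    open ℚSolver.+-*-Solver
    lemma : ∀ a b c → (a ℚ.- b) ℚ.+ (b ℚ.- c) ≡ a ℚ.- c
    lemma = solve 3 (λ a b c → (a :- b) :+ (b :- c) := a :- c) refl

  +ℝ-cong : ∀ x x′ y y′ → x ≈ℝ x′ → y ≈ℝ y′ → x +ℝ y ≈ℝ x′ +ℝ y′
  +ℝ-cong x x′ y y′ p q = null⇒≈ (x +ℝ y) (x′ +ℝ y′)
    (null-cong (λ m n → dist x x′ m n ℚ.+ dist y y′ m n) (dist (x +ℝ y) (x′ +ℝ y′))
      (λ m _ → sum-diff (seq x m) (seq y m) (seq x′ m) (seq y′ m))
      (null-+ (dist x x′) (dist y y′) (≈⇒null x x′ p) (≈⇒null y y′ q)))

  -ℝ-cong : ∀ x x′ → x ≈ℝ x′ → -ℝ x ≈ℝ -ℝ x′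
  -ℝ-cong x x′ p = null⇒≈ (-ℝ x) (-ℝ x′)
    (null-cong (λ m n → ℚ.- dist x x′ m n) (dist (-ℝ x) (-ℝ x′))
      (λ m _ → neg-diff (seq x m) (seq x′ m))
      (null-neg (dist x x′) (≈⇒null x x′ p)))

  *ℝ-cong : ∀ x x′ y y′ → x ≈ℝ x′ → y ≈ℝ y′ → x *ℝ y ≈ℝ x′ *ℝ y′
  *ℝ-cong x x′ y y′ p q = null⇒≈ (x *ℝ y) (x′ *ℝ y′)
    (null-cong (λ m n → seq x m ℚ.* dist y y′ m n ℚ.+ seq y′ m ℚ.* dist x x′ m n)
      (dist (x *ℝ y) (x′ *ℝ y′))
      (λ m _ → product-diff (seq x m) (seq y m) (seq x′ m) (seq y′ m))
      (null-+ (λ m n → seq x m ℚ.* dist y y′ m n) (λ m n → seq y′ m ℚ.* dist x x′ m n)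
        (null-* (seq x) (dist y y′) (λ m _ → m) fst-large
          (cauchy⇒bounded (seq x) (cauchy x)) (≈⇒null y y′ q))
        (null-* (seq y′) (dist x x′) (λ m _ → m) fst-large
          (cauchy⇒bounded (seq y′) (cauchy y′)) (≈⇒null x x′ p))))

ℝ-commutativeRing : CommutativeRing 0ℓ 0ℓ
ℝ-commutativeRing = record
  { Carrier = ℝ
  ; _≈_ = _≈ℝ_
  ; _+_ = _+ℝ_
  ; _*_ = _*ℝ_
  ; -_ = -ℝ_
  ; 0# = constℝ 0ℚ
  ; 1# = constℝ 1ℚ
  ; isCommutativeRing = record
    { isRing = record
      { +-isAbelianGroup = record
        { isGroup = record
          { isMonoid = record
            { isSemigroup = record
              { isMagma = record
                { isEquivalence = record
                  { refl = λ {x} → ptwise x x (λ _ → refl)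
                  ; sym = λ {x} {y} → ≈ℝ-sym x y
                  ; trans = λ {x} {y} {z} → ≈ℝ-trans x y z
                  }
                ; ∙-cong = λ {x} {x′} {y} {y′} → +ℝ-cong x x′ y y′
                }
              ; assoc = λ x y z → ptwise ((x +ℝ y) +ℝ z) (x +ℝ (y +ℝ z))
                  (λ n → ℚ.+-assoc (seq x n) (seq y n) (seq z n))
              }
            ; identity = (λ x → ptwise (constℝ 0ℚ +ℝ x) x (λ n → ℚ.+-identityˡ (seq x n)))
                       , (λ x → ptwise (x +ℝ constℝ 0ℚ) x (λ n → ℚ.+-identityʳ (seq x n)))
            }
          ; inverse = (λ x → ptwise (-ℝ x +ℝ x) (constℝ 0ℚ) (λ n → ℚ.+-inverseˡ (seq x n)))
                    , (λ x → ptwise (x +ℝ -ℝ x) (constℝ 0ℚ) (λ n → ℚ.+-inverseʳ (seq x n)))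
          ; ⁻¹-cong = λ {x} {y} → -ℝ-cong x y
          }
        ; comm = λ x y → ptwise (x +ℝ y) (y +ℝ x) (λ n → ℚ.+-comm (seq x n) (seq y n))
        }
      ; *-cong = λ {x} {x′} {y} {y′} → *ℝ-cong x x′ y y′
      ; *-assoc = λ x y z → ptwise ((x *ℝ y) *ℝ z) (x *ℝ (y *ℝ z))
          (λ n → ℚ.*-assoc (seq x n) (seq y n) (seq z n))
      ; *-identity = (λ x → ptwise (constℝ 1ℚ *ℝ x) x (λ n → ℚ.*-identityˡ (seq x n)))
                   , (λ x → ptwise (x *ℝ constℝ 1ℚ) x (λ n → ℚ.*-identityʳ (seq x n)))
      ; distrib = (λ x y z → ptwise (x *ℝ (y +ℝ z)) (x *ℝ y +ℝ x *ℝ z)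
                    (λ n → ℚ.*-distribˡ-+ (seq x n) (seq y n) (seq z n)))
                , (λ x y z → ptwise ((y +ℝ z) *ℝ x) (y *ℝ x +ℝ z *ℝ x)
                    (λ n → ℚ.*-distribʳ-+ (seq x n) (seq y n) (seq z n)))
      }
    ; *-comm = λ x y → ptwise (x *ℝ y) (y *ℝ x) (λ n → ℚ.*-comm (seq x n) (seq y n))
    }
  }

private
  module R = CommutativeRing ℝ-commutativeRing

infix 6 _+i_
record ℂ : Set where
  constructor _+i_
  field
    re im : ℝ
open ℂ public

infix 4 _≈ℂ_
infixr 4 _+i≈_
record _≈ℂ_ (z w : ℂ) : Set where
  constructor _+i≈_
  field
    re≈ : re z R.≈ re w
    im≈ : im z R.≈ im w
open _≈ℂ_ public

infixl 6 _+ℂ_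
infixl 7 _*ℂ_
infix  8 -ℂ_

_+ℂ_ : ℂ → ℂ → ℂ
(a +i b) +ℂ (c +i d) = (a R.+ c) +i (b R.+ d)

-ℂ_ : ℂ → ℂ
-ℂ (a +i b) = (R.- a) +i (R.- b)

_*ℂ_ : ℂ → ℂ → ℂ
(a +i b) *ℂ (c +i d) = (a R.* c R.+ R.- (b R.* d)) +i (a R.* d R.+ b R.* c)

0ℂ 1ℂ : ℂ
0ℂ = R.0# +i R.0#
1ℂ = R.1# +i R.0#

private
  -- Proved for an arbitrary ring, so that the solver does not unfold ℝ.
  module Identities {c ℓ} (K : CommutativeRing c ℓ) where
    open CommutativeRing K renaming (refl to ≈-refl; sym to ≈-sym; trans to ≈-trans)
    open SemiringSolver commutativeSemiring using (solve; _:=_; _:+_; _:*_)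

    -- Negation becomes multiplication by a variable, for the semiring solver.
    neg : ∀ x → - x ≈ - 1# * x
    neg x = ≈-sym (-1*x≈-x ring x)

    assoc-re : ∀ a b c d e f →
      (a * c + - (b * d)) * e + - ((a * d + b * c) * f) ≈
      a * (c * e + - (d * f)) + - (b * (c * f + d * e))
    assoc-re a b c d e f =
      ≈-trans (+-cong (*-congʳ (+-congˡ (neg _))) (neg _))
      (≈-trans
        (solve 7 (λ m a b c d e f →
          (a :* c :+ m :* (b :* d)) :* e :+ m :* ((a :* d :+ b :* c) :* f) :=
          a :* (c :* e :+ m :* (d :* f)) :+ m :* (b :* (c :* f :+ d :* e)))
          ≈-refl (- 1#) a b c d e f)
        (≈-sym (+-cong (*-congˡ (+-congˡ (neg _))) (neg _))))

    assoc-im : ∀ a b c d e f →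
      (a * c + - (b * d)) * f + (a * d + b * c) * e ≈
      a * (c * f + d * e) + b * (c * e + - (d * f))
    assoc-im a b c d e f =
      ≈-trans (+-congʳ (*-congʳ (+-congˡ (neg _))))
      (≈-trans
        (solve 7 (λ m a b c d e f →
          (a :* c :+ m :* (b :* d)) :* f :+ (a :* d :+ b :* c) :* e :=
          a :* (c :* f :+ d :* e) :+ b :* (c :* e :+ m :* (d :* f)))
          ≈-refl (- 1#) a b c d e f)
        (≈-sym (+-congˡ (*-congˡ (+-congˡ (neg _))))))

    comm-re : ∀ a b c d → a * c + - (b * d) ≈ c * a + - (d * b)
    comm-re a b c d = +-cong (*-comm a c) (-‿cong (*-comm b d))

    comm-im : ∀ a b c d → a * d + b * c ≈ c * b + d * a
    comm-im a b c d = ≈-trans (+-cong (*-comm a d) (*-comm b c)) (+-comm (d * a) (c * b))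

    distrib-re : ∀ a b c d e f →
      a * (c + e) + - (b * (d + f)) ≈ (a * c + - (b * d)) + (a * e + - (b * f))
    distrib-re a b c d e f =
      ≈-trans (+-congˡ (neg _))
      (≈-trans
        (solve 7 (λ m a b c d e f →
          a :* (c :+ e) :+ m :* (b :* (d :+ f)) :=
          (a :* c :+ m :* (b :* d)) :+ (a :* e :+ m :* (b :* f)))
          ≈-refl (- 1#) a b c d e f)
        (≈-sym (+-cong (+-congˡ (neg _)) (+-congˡ (neg _)))))

    distrib-im : ∀ a b c d e f →
      a * (d + f) + b * (c + e) ≈ (a * d + b * c) + (a * f + b * e)
    distrib-im = solve 6 (λ a b c d e f →
      a :* (d :+ f) :+ b :* (c :+ e) := (a :* d :+ b :* c) :+ (a :* f :+ b :* e)) ≈-refl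

  module ℂ-laws where
    open Identities ℝ-commutativeRing

    *-assoc : ∀ x y z → (x *ℂ y) *ℂ z ≈ℂ x *ℂ (y *ℂ z)
    *-assoc (a +i b) (c +i d) (e +i f) = assoc-re a b c d e f +i≈ assoc-im a b c d e f

    *-comm : ∀ x y → x *ℂ y ≈ℂ y *ℂ x
    *-comm (a +i b) (c +i d) = comm-re a b c d +i≈ comm-im a b c d

    distribˡ : ∀ x y z → x *ℂ (y +ℂ z) ≈ℂ x *ℂ y +ℂ x *ℂ z
    distribˡ (a +i b) (c +i d) (e +i f) = distrib-re a b c d e f +i≈ distrib-im a b c d e f

    -0≈0 : R.- R.0# R.≈ R.0#
    -0≈0 = R.trans (R.sym (R.+-identityˡ (R.- R.0#))) (R.-‿inverseʳ R.0#)

    *-identityˡ : ∀ x → 1ℂ *ℂ x ≈ℂ x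
    *-identityˡ (a +i b) =
      R.trans (R.+-cong (R.*-identityˡ a) (R.trans (R.-‿cong (R.zeroˡ b)) -0≈0)) (R.+-identityʳ a) +i≈
      R.trans (R.+-cong (R.*-identityˡ b) (R.zeroˡ a)) (R.+-identityʳ b)

    ≈ℂ-trans : ∀ {x y z} → x ≈ℂ y → y ≈ℂ z → x ≈ℂ z
    ≈ℂ-trans (p +i≈ q) (r +i≈ s) = R.trans p r +i≈ R.trans q s

    distribʳ : ∀ x y z → (y +ℂ z) *ℂ x ≈ℂ y *ℂ x +ℂ z *ℂ x
    distribʳ x y z = ≈ℂ-trans (*-comm (y +ℂ z) x) (≈ℂ-trans (distribˡ x y z)
      (R.+-cong (re≈ (*-comm x y)) (re≈ (*-comm x z)) +i≈
       R.+-cong (im≈ (*-comm x y)) (im≈ (*-comm x z))))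

ℂ-commutativeRing : CommutativeRing 0ℓ 0ℓ
ℂ-commutativeRing = record
  { Carrier = ℂ
  ; _≈_ = _≈ℂ_
  ; _+_ = _+ℂ_
  ; _*_ = _*ℂ_
  ; -_ = -ℂ_
  ; 0# = 0ℂ
  ; 1# = 1ℂ
  ; isCommutativeRing = record
    { isRing = record
      { +-isAbelianGroup = record
        { isGroup = record
          { isMonoid = record
            { isSemigroup = record
              { isMagma = record
                { isEquivalence = record
                  { refl = R.refl +i≈ R.refl
                  ; sym = λ (p +i≈ q) → R.sym p +i≈ R.sym q
                  ; trans = ≈ℂ-trans
                  }
                ; ∙-cong = λ (p +i≈ q) (r +i≈ s) → R.+-cong p r +i≈ R.+-cong q s
                }
              ; assoc = λ x y z → R.+-assoc (re x) (re y) (re z) +i≈ R.+-assoc (im x) (im y) (im z)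
              }
            ; identity = (λ x → R.+-identityˡ (re x) +i≈ R.+-identityˡ (im x))
                       , (λ x → R.+-identityʳ (re x) +i≈ R.+-identityʳ (im x))
            }
          ; inverse = (λ x → R.-‿inverseˡ (re x) +i≈ R.-‿inverseˡ (im x))
                    , (λ x → R.-‿inverseʳ (re x) +i≈ R.-‿inverseʳ (im x))
          ; ⁻¹-cong = λ (p +i≈ q) → R.-‿cong p +i≈ R.-‿cong q
          }
        ; comm = λ x y → R.+-comm (re x) (re y) +i≈ R.+-comm (im x) (im y)
        }
      ; *-cong = λ (p +i≈ q) (r +i≈ s) →
          R.+-cong (R.*-cong p r) (R.-‿cong (R.*-cong q s)) +i≈
          R.+-cong (R.*-cong p s) (R.*-cong q r)
      ; *-assoc = *-assoc
      ; *-identity = *-identityˡ , λ x → ≈ℂ-trans (*-comm x 1ℂ) (*-identityˡ x)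
      ; distrib = distribˡ , distribʳ
      }
    ; *-comm = *-comm
    }
  }
  where open ℂ-laws

-- Laurent polynomials in q with integer coefficients: a list of pairs
-- (c , e) stands for the sum of the monomials c qᵉ.

module Laurent where

  Laurent : Set
  Laurent = List (ℤ × ℤ)

  coefficient : Laurent → ℤ → ℤ
  coefficient []            k = + 0
  coefficient ((c , e) ∷ p) k =
    (if does (e ℤ.≟ k) then c else + 0) ℤ.+ coefficient p k

  rawRing : RawRing 0ℓ 0ℓ
  rawRing = record
    { Carrier = Laurent
    ; _≈_ = λ p s → ∀ k → coefficient p k ≡ coefficient s k
    ; _+_ = _++_
    ; _*_ = List.cartesianProductWith (λ (c , e) (d , f) → c ℤ.* d , e ℤ.+ f)
    ; -_ = List.map (λ (c , e) → ℤ.- c , e)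
    ; 0# = []
    ; 1# = (+ 1 , + 0) ∷ []
    }

  open RawRing rawRing public
    using (_≈_; _+_; _*_; -_; 0#; 1#)
  open RawSemiringDefs (RawRing.rawSemiring rawRing) public
    using (_^_; sum) renaming (_×_ to _·_)

  q q⁻¹ : Laurent
  q   = (+ 1 , + 1) ∷ []
  q⁻¹ = (+ 1 , ℤ.-[1+ 0 ]) ∷ []

subsets : ∀ n → List (Subset n)
subsets zero    = Vec.[] ∷ []
subsets (suc n) = List.map (outside Vec.∷_) (subsets n) ++ List.map (inside Vec.∷_) (subsets n)

-- The definitions below are meant for K = ℂ; an abstract K keeps ℂ from being
-- unfolded.

private
  module Ring (K : CommutativeRing 0ℓ 0ℓ) where
    open CommutativeRing K public
    open RawSemiringDefs (RawRing.rawSemiring rawRing) public using (_^_; sum; product)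

module _ {m ℓm : Level} {K : CommutativeRing 0ℓ 0ℓ} (M : Module K m ℓm) where
  private module K = Ring K
  open Module M
  open RawMonoidDefs +ᴹ-rawMonoid using (sum)

  linearCombination : ∀ {k} → Vector K.Carrier k → Vector Carrierᴹ k → Carrierᴹ
  linearCombination c v = sum (λ i → c i *ₗ v i)

  Span : ∀ {k} → Vector Carrierᴹ k → Pred Carrierᴹ ℓm
  Span v x = ∃[ c ] x ≈ᴹ linearCombination c v

  LinearlyIndependent : ∀ {k} → Vector Carrierᴹ k → Set ℓm
  LinearlyIndependent v = ∀ c → linearCombination c v ≈ᴹ 0ᴹ → ∀ i → c i K.≈ K.0#

  -- Independence of the subfamily (vᵢ) for i ∈ S, whose linear combinations
  -- are those of v with coefficients vanishing outside S.
  LinearlyIndependentOn : ∀ {k} → Subset k → Vector Carrierᴹ k → Set ℓm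
  LinearlyIndependentOn S v =
    ∀ c → (∀ i → i ∉ S → c i K.≈ K.0#) → linearCombination c v ≈ᴹ 0ᴹ → ∀ i → c i K.≈ K.0#

  HasDimension : ∀ {p} → Pred Carrierᴹ p → ℕ → Set (m ⊔ ℓm ⊔ p)
  HasDimension P d = Σ[ v ∈ Vector Carrierᴹ d ]
    (∀ i → P (v i)) × LinearlyIndependent v × (∀ x → P x → Span v x)

  FiniteDimensional : Set (m ⊔ ℓm)
  FiniteDimensional = ∃[ d ] HasDimension U d

module _ {m ℓm : Level} {K : CommutativeRing 0ℓ 0ℓ} (V : Module K m ℓm) where
  private module K = Ring K
  open Module V
  open ModuleMorphisms rawModule (TensorUnit.rawModule {R = K.rawRing})

  record LinearForm : Set (m ⊔ ℓm) where
    field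
      fun                  : Carrierᴹ → K.Carrier
      isModuleHomomorphism : IsModuleHomomorphism fun

  -- All functions V → K, with pointwise operations; it contains both the
  -- dual space of V and the polynomial functions on V as subspaces.
  functionModule : Module K m m
  functionModule = record
    { Carrierᴹ = Carrierᴹ → K.Carrier
    ; _≈ᴹ_ = F._≈_
    ; _+ᴹ_ = F._+_
    ; _*ₗ_ = λ c f x → c K.* f x
    ; _*ᵣ_ = λ f c x → c K.* f x
    ; 0ᴹ = F.0#
    ; -ᴹ_ = F.-_
    ; isModule = IsModuleFromLeft.isModule {commutativeRing = K} record
      { isLeftModule = record
        { isLeftSemimodule = record
          { +ᴹ-isCommutativeMonoid = F.+-isCommutativeMonoid
          ; isPreleftSemimodule = record
            { *ₗ-cong = λ c≈d f≈g x → K.*-cong c≈d (f≈g x)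
            ; *ₗ-zeroˡ = λ f x → K.zeroˡ (f x)
            ; *ₗ-distribʳ = λ f c d x → K.distribʳ (f x) c d
            ; *ₗ-identityˡ = λ f x → K.*-identityˡ (f x)
            ; *ₗ-assoc = λ c d f x → K.*-assoc c d (f x)
            ; *ₗ-zeroʳ = λ c x → K.zeroʳ c
            ; *ₗ-distribˡ = λ c f g x → K.distribˡ c (f x) (g x)
            }
          }
        ; -ᴹ‿cong = F.-‿cong
        ; -ᴹ‿inverse = F.-‿inverse
        }
      }
    }
    where
    module F = CommutativeRing (Pointwise.commutativeRing Carrierᴹ K)

  IsHomogeneous : ℕ → Pred (Carrierᴹ → K.Carrier) (m ⊔ ℓm)
  IsHomogeneous d f = ∃[ k ] Σ[ c ∈ Vector K.Carrier k ] Σ[ φ ∈ (Fin k → Fin d → LinearForm) ]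
    (∀ x → f x K.≈ K.sum (λ i → c i K.* K.product (λ j → LinearForm.fun (φ i j) x)))

  IsPolynomial : Pred (Carrierᴹ → K.Carrier) (m ⊔ ℓm)
  IsPolynomial f = ∃[ N ] Σ[ g ∈ Vector (Carrierᴹ → K.Carrier) N ]
    (∀ d → IsHomogeneous (toℕ d) (g d)) × (∀ x → f x K.≈ K.sum (λ d → g d x))

  -- The restriction of f to the line x + K h is a polynomial in t of degree at
  -- most k; the zero function always qualifies.
  DegreeOnLine≤ : ℕ → (Carrierᴹ → K.Carrier) → Carrierᴹ → Carrierᴹ → Set
  DegreeOnLine≤ k f x h = Σ[ a ∈ Vector K.Carrier (suc k) ]
    (∀ t → f (x +ᴹ t *ₗ h) K.≈ K.sum (λ j → a j K.* t K.^ toℕ j))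

  -- Each graded piece Pᵢ has dimension d i, almost all d i vanish, and
  -- H = Σᵢ (d i) qⁱ.
  HasHilbertSeries : ∀ {p} → Pred (Carrierᴹ → K.Carrier) p → Laurent.Laurent → Set (m ⊔ ℓm ⊔ p)
  HasHilbertSeries P H = Σ[ d ∈ (ℕ → ℕ) ] ∃[ N ]
    (∀ i → HasDimension functionModule (λ f → P f × IsHomogeneous i f) (d i)) ×
    (∀ i → N ℕ.≤ i → d i ≡ 0) ×
    Laurent.sum {N} (λ i → d (toℕ i) Laurent.· (Laurent.q Laurent.^ toℕ i)) Laurent.≈ H

  -- The i-th hyperplane is the kernel of the i-th form; zero forms (loops)
  -- and repetitions are allowed.
  Arrangement : ℕ → Set (m ⊔ ℓm)
  Arrangement n = Fin n → LinearForm

module _ {m ℓm : Level} {K : CommutativeRing 0ℓ 0ℓ} {V : Module K m ℓm} {n : ℕ}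
         (A : Arrangement V n) where
  private module K = Ring K
  open Module V

  forms : Vector (Carrierᴹ → K.Carrier) n
  forms i = LinearForm.fun (A i)

  HasRank : ℕ → Set m
  HasRank = HasDimension (functionModule V) (Span (functionModule V) forms)

  -- Excluded middle decides linear independence and the vanishing of complex
  -- numbers, so that ranks and ρ are natural numbers as in classical mathematics.
  module _ (em : ∀ {ℓ} → ExcludedMiddle ℓ) where

    -- The largest size of an independent subset of S.
    matroidRank : Subset n → ℕ
    matroidRank S = max 0 (List.map ∣_∣ (List.filter
      (λ T → em {P = T ⊆ S × LinearlyIndependentOn (functionModule V) T forms}) (subsets n)))

    -- The value at (x , y) of the Tutte polynomial of an arrangement of rank r.
    tutte : ∀ {c ℓ} (R : RawRing c ℓ) → ℕ → RawRing.Carrier R → RawRing.Carrier R → RawRing.Carrier R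
    tutte R r x y = List.foldr _+_ 0# (List.map term (subsets n))
      where
      open RawRing R
      open RawSemiringDefs rawSemiring using (_^_)
      term : Subset n → Carrier
      term S = (x + - 1#) ^ (r ∸ matroidRank S) * (y + - 1#) ^ (∣ S ∣ ∸ matroidRank S)

    ρ : Carrierᴹ → ℕ
    ρ h = Vec.count (λ i → em {P = ¬ (forms i h K.≈ K.0#)}) (Vec.allFin n)

    C₀ : Pred (Carrierᴹ → K.Carrier) (m ⊔ ℓm)
    C₀ f = IsPolynomial V f × (∀ h → ¬ (h ≈ᴹ 0ᴹ) → ∀ x → DegreeOnLine≤ V (ρ h) f x h)

module Submission where

-- Multiplication by a nonzero form l of A embeds the space C of the deletion A \ l
-- into that of A, shifting degrees by one, and its image consists of the functions
-- in C of A that vanish on the hyperplane l = 0.  Restriction to the hyperplane maps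
-- C of A into C of the contraction A / l.  If the latter has a basis of products of
-- forms, these lift to products of forms of A, so restriction is onto and C of A has
-- such a basis too.  Hence Hilb(A) = q Hilb(A \ l) + Hilb(A / l), which is the
-- deletion-contraction recursion of q^(n-r) T(1+q, 1/q) = Σ q^(n-|S|) (1-q)^(|S|-r(S)).
--
-- The restriction of f is represented on all of V by f ∘ π, where π is a projection
-- onto the hyperplane; the contraction is then again an arrangement in V.

open import Defs
open import Algebra.Bundles using (CommutativeMonoid; CommutativeRing; RawRing)
import Algebra.Definitions.RawMonoid as RawMonoidDefs
import Algebra.Definitions.RawSemiring as RawSemiringDefs
open import Algebra.Module.Bundles using (Module)
import Algebra.Module.Construct.TensorUnit as TensorUnit
open import Algebra.Module.Morphism.Structures using (module ModuleMorphisms)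
open import Algebra.Solver.Ring.AlmostCommutativeRing
open import Algebra.Structures using (IsCommutativeRing)
open import Axiom.DoubleNegationElimination using (em⇒dne)
open import Axiom.ExcludedMiddle using (ExcludedMiddle)
open import Data.Bool.Base using (if_then_else_; true; false)
open import Data.Fin.Base
  using (Fin; toℕ; fromℕ; zero; suc; punchIn; punchOut; _↑ˡ_; _↑ʳ_; splitAt; join)
import Data.Fin.Properties as Fin
open import Data.Fin.Subset using (Subset; inside; outside; ∣_∣; _∈_; _∉_; _⊆_; ⊥; ⊤)
open import Data.Fin.Subset.Properties
  using (drop-there; drop-∷-⊆; out⊆; in⊆in; ⊥⊆; ∉⊥; ∣⊥∣≡0; ∣⊤∣≡n; ∣p∣≤n; p⊆q⇒∣p∣≤∣q∣)
open import Data.Integer.Base as ℤ using (ℤ; +_; -[1+_])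
import Data.Integer.Properties as ℤ
import Data.Integer.Solver as ℤSolver
open import Data.List.Base as List using (List)
open import Data.List.Extrema.Nat using (max; xs≤max; argmax-sel)
open import Data.List.Membership.Propositional using () renaming (_∈_ to _∈ₗ_)
open import Data.List.Membership.Propositional.Properties
  using (∈-map⁺; ∈-map⁻; ∈-filter⁺; ∈-filter⁻; ∈-++⁺ˡ; ∈-++⁺ʳ)
import Data.List.Properties as List
import Data.List.Relation.Unary.All as All
import Data.List.Relation.Unary.Any as Any
open import Data.Maybe.Base using (Maybe; just; nothing)
open import Data.Nat.Base as ℕ using (ℕ; zero; suc; _∸_; z≤n; s≤s)
import Data.Nat.Properties as ℕ
open import Data.Product.Base using (Σ-syntax; ∃-syntax; _×_; _,_; proj₁; proj₂)
open import Data.Rational.Base as ℚ using (ℚ; 0ℚ; 1ℚ)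
import Data.Rational.Properties as ℚ
import Data.Rational.Solver as ℚSolver
open import Data.Sum.Base using (inj₁; inj₂; [_,_])
open import Data.Unit.Base using (tt) renaming (⊤ to Unit)
open import Data.Vec.Base as Vec using (here; there)
open import Data.Vec.Functional using (Vector)
open import Data.Vec.Functional.Properties using (lookup-++ˡ; lookup-++ʳ)
open import Function.Base using (_∘_; const; id)
open import Level using (Level; 0ℓ; _⊔_)
open import Relation.Binary.Core using (Rel)
open import Relation.Binary.PropositionalEquality as ≡ using (_≡_)
open import Relation.Nullary using (¬_; yes; no; does; contradiction)
open import Relation.Unary using (Pred; Decidable)

-- The delicate point is division by l. If l g obeys the bounds of A, then g must obey those of the
-- deletion. Along a direction outside the kernel of l both the degree and the bound drop by one.
-- Along a direction inside the kernel the bound is unchanged and l is constant on each line, so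
-- division is harmless unless the line lies in the hyperplane, where l g = 0 says nothing about g.
-- Such a line is reached as a limit of parallel ones, in algebraic form: the value of a polynomial
-- at 0 is a linear combination of its values at nonzero points. Characteristic zero enters here,
-- since powers of 2 must differ from 1.
--
-- That restriction is onto cannot be read off the degree bounds, because an arbitrary function on
-- the hyperplane has no evident extension that obeys the bounds of A. A product of distinct members
-- of the list of forms always obeys them. This is why the induction carries bases of such products
-- and not only dimensions.
--
-- The rank r is absent from the subset sum, so the ranks of the deletion and of the contraction
-- never have to be followed, and a coloop is treated like any other nonzero form.

-- Ring identities with integer coefficients

module IntegerRingSolver {c ℓ : Level} (K : CommutativeRing c ℓ) where
  open CommutativeRing K
  open import Algebra.Properties.Semiring.Mult.TCOptimised semiring
    using (1+×; ×-homo-+; ×1-homo-*) renaming (_×_ to _·_)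
  open import Algebra.Properties.Ring ring
  open import Algebra.Properties.AbelianGroup +-abelianGroup using (⁻¹-∙-comm)
  open import Relation.Binary.Reasoning.Setoid setoid

  private
    -- Coefficients are integers because their equality is decidable, unlike that of `K`. With the
    -- optimised multiples `1 · 1#` reduces to `1#`, so `con (+ 1)` denotes `1#` on the nose.
    ⟦_⟧ : ℤ → Carrier
    ⟦ + n ⟧      = n · 1#
    ⟦ -[1+ n ] ⟧ = - (suc n · 1#)

    -0≈0 : - 0# ≈ 0#
    -0≈0 = trans (sym (+-identityˡ _)) (-‿inverseʳ 0#)

    cancel-1 : ∀ a b → (1# + a) - (1# + b) ≈ a - b
    cancel-1 a b = begin
      (1# + a) - (1# + b)     ≈⟨ +-cong (+-comm 1# a) (sym (⁻¹-∙-comm 1# b)) ⟩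
      (a + 1#) + (- 1# - b)   ≈⟨ +-assoc a 1# _ ⟩
      a + (1# + (- 1# - b))   ≈⟨ +-congˡ (sym (+-assoc 1# _ _)) ⟩
      a + ((1# - 1#) - b)     ≈⟨ +-congˡ (+-congʳ (-‿inverseʳ 1#)) ⟩
      a + (0# - b)            ≈⟨ +-congˡ (+-identityˡ _) ⟩
      a - b                   ∎

    ⊖-homo : ∀ m n → ⟦ m ℤ.⊖ n ⟧ ≈ m · 1# - n · 1#
    ⊖-homo m       zero    = sym (trans (+-congˡ -0≈0) (+-identityʳ _))
    ⊖-homo zero    (suc n) = sym (+-identityˡ _)
    ⊖-homo (suc m) (suc n) = begin
      ⟦ suc m ℤ.⊖ suc n ⟧             ≡⟨ ≡.cong ⟦_⟧ (ℤ.[1+m]⊖[1+n]≡m⊖n m n) ⟩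
      ⟦ m ℤ.⊖ n ⟧                     ≈⟨ ⊖-homo m n ⟩
      m · 1# - n · 1#                 ≈⟨ cancel-1 _ _ ⟨
      (1# + m · 1#) - (1# + n · 1#)   ≈⟨ +-cong (1+× m 1#) (-‿cong (1+× n 1#)) ⟨
      suc m · 1# - suc n · 1#         ∎

    +-homo : ∀ i j → ⟦ i ℤ.+ j ⟧ ≈ ⟦ i ⟧ + ⟦ j ⟧
    +-homo (+ m)      (+ n)      = ×-homo-+ 1# m n
    +-homo (+ m)      (-[1+ n ]) = ⊖-homo m (suc n)
    +-homo (-[1+ m ]) (+ n)      = trans (⊖-homo n (suc m)) (+-comm _ _)
    +-homo (-[1+ m ]) (-[1+ n ]) = begin
      - (suc (suc (m ℕ.+ n)) · 1#)     ≡⟨ ≡.cong (λ k → - (suc k · 1#)) (≡.sym (ℕ.+-suc m n)) ⟩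
      - ((suc m ℕ.+ suc n) · 1#)       ≈⟨ -‿cong (×-homo-+ 1# (suc m) (suc n)) ⟩
      - (suc m · 1# + suc n · 1#)      ≈⟨ ⁻¹-∙-comm _ _ ⟨
      - (suc m · 1#) - (suc n · 1#)    ∎

    -‿homo : ∀ i → ⟦ ℤ.- i ⟧ ≈ - ⟦ i ⟧
    -‿homo (+ zero)   = sym -0≈0
    -‿homo (+ suc n)  = refl
    -‿homo (-[1+ n ]) = sym (-‿involutive _)

    *-homo : ∀ i j → ⟦ i ℤ.* j ⟧ ≈ ⟦ i ⟧ * ⟦ j ⟧
    *-homo (+ m) (+ n) = trans (reflexive (≡.cong ⟦_⟧ (≡.sym (ℤ.pos-* m n)))) (×1-homo-* m n)
    *-homo (+ m) (-[1+ n ]) = begin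
      ⟦ + m ℤ.* -[1+ n ] ⟧        ≡⟨ ≡.cong ⟦_⟧ (ℤ.neg-distribʳ-* (+ m) (+ suc n)) ⟨
      ⟦ ℤ.- (+ m ℤ.* + suc n) ⟧   ≈⟨ -‿homo (+ m ℤ.* + suc n) ⟩
      - ⟦ + m ℤ.* + suc n ⟧       ≈⟨ -‿cong (*-homo (+ m) (+ suc n)) ⟩
      - (m · 1# * suc n · 1#)     ≈⟨ -‿distribʳ-* _ _ ⟩
      (m · 1#) * - (suc n · 1#)     ∎
    *-homo (-[1+ m ]) (+ n) = begin
      ⟦ -[1+ m ] ℤ.* + n ⟧        ≡⟨ ≡.cong ⟦_⟧ (ℤ.neg-distribˡ-* (+ suc m) (+ n)) ⟨
      ⟦ ℤ.- (+ suc m ℤ.* + n) ⟧   ≈⟨ -‿homo (+ suc m ℤ.* + n) ⟩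
      - ⟦ + suc m ℤ.* + n ⟧       ≈⟨ -‿cong (*-homo (+ suc m) (+ n)) ⟩
      - ((suc m · 1#) * (n · 1#))     ≈⟨ -‿distribˡ-* _ _ ⟩
      - (suc m · 1#) * (n · 1#)     ∎
    *-homo (-[1+ m ]) (-[1+ n ]) = begin
      ⟦ + suc m ℤ.* + suc n ⟧            ≈⟨ *-homo (+ suc m) (+ suc n) ⟩
      (suc m · 1#) * (suc n · 1#)            ≈⟨ -‿involutive _ ⟨
      - - ((suc m · 1#) * (suc n · 1#))      ≈⟨ -‿cong (-‿distribˡ-* _ _) ⟩
      - (- (suc m · 1#) * (suc n · 1#))    ≈⟨ -‿distribʳ-* _ _ ⟩
      - (suc m · 1#) * - (suc n · 1#)    ∎

    morphism : ℤ.+-*-rawRing -Raw-AlmostCommutative⟶ fromCommutativeRing K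
    morphism = record
      { ⟦_⟧    = ⟦_⟧
      ; +-homo = +-homo
      ; *-homo = *-homo
      ; -‿homo = -‿homo
      ; 0-homo = refl
      ; 1-homo = refl
      }

    _coeff≟_ : ∀ i j → Maybe (⟦ i ⟧ ≈ ⟦ j ⟧)
    i coeff≟ j with i ℤ.≟ j
    ... | yes i≡j = just (reflexive (≡.cong ⟦_⟧ i≡j))
    ... | no  _   = nothing

  open import Algebra.Solver.Ring ℤ.+-*-rawRing (fromCommutativeRing K) morphism _coeff≟_ public

-- The complex numbers as a field of characteristic zero

module ComplexField where
  open ≡ using (refl; sym; trans; cong; cong₂; subst)

  private
    ≤⇒≯ : ∀ {p q} → p ℚ.≤ q → ¬ (q ℚ.< p)
    ≤⇒≯ p≤q q<p = ℚ.<-irrefl refl (ℚ.<-≤-trans q<p p≤q)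

  module RealInverse (em : ExcludedMiddle 0ℓ) where
    open NullSequences

    AwayFromZero : (ℕ → ℚ) → Set
    AwayFromZero x = Σ[ δ ∈ ℚ ] ℚ.Positive δ × (∃[ N ] ∀ n → N ℕ.≤ n → δ ℚ.≤ ℚ.∣ x n ∣)

    private
      half : ∀ ε → 0ℚ ℚ.< ε → 0ℚ ℚ.< ℚ.½ ℚ.* ε
      half ε 0<ε = subst (ℚ._< ℚ.½ ℚ.* ε) (ℚ.*-zeroʳ ℚ.½) (ℚ.*-monoʳ-<-pos ℚ.½ 0<ε)

      halves : ∀ ε → ℚ.½ ℚ.* ε ℚ.+ ℚ.½ ℚ.* ε ≡ ε
      halves ε = trans (sym (ℚ.*-distribʳ-+ ε ℚ.½ ℚ.½)) (ℚ.*-identityˡ ε)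

      minus-plus : ∀ a b → (a ℚ.- b) ℚ.+ b ≡ a
      minus-plus = solve 2 (λ a b → (a :- b) :+ b := a) refl
        where open ℚSolver.+-*-Solver

    -- If one term beyond the Cauchy modulus for `½ ε` has absolute value at least `ε`, then all
    -- terms beyond it have absolute value at least `½ ε`. A sequence that is not bounded away from
    -- zero is therefore null.
    nonzero⇒away : ∀ x → ¬ (x ≈ℝ constℝ 0ℚ) → AwayFromZero (seq x)
    nonzero⇒away x x≉0 with em {P = AwayFromZero (seq x)}
    ... | yes away    = away
    ... | no  ¬away = contradiction (mk≈ small) x≉0
      where
      small : ∀ ε → 0ℚ ℚ.< ε → ∃[ N ] ∀ n → N ℕ.≤ n → ℚ.∣ seq x n ℚ.- 0ℚ ∣ ℚ.< ε
      small ε 0<ε = N , λ m N≤m → subst (λ a → ℚ.∣ a ∣ ℚ.< ε) (sym (ℚ.+-identityʳ (seq x m))) (bound m N≤m)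
        where
        N : ℕ
        N = proj₁ (cauchy x (ℚ.½ ℚ.* ε) (half ε 0<ε))
        close′ = proj₂ (cauchy x (ℚ.½ ℚ.* ε) (half ε 0<ε))
        bound : ∀ m → N ℕ.≤ m → ℚ.∣ seq x m ∣ ℚ.< ε
        bound m N≤m with ℚ.∣ seq x m ∣ ℚ.<? ε
        ... | yes p = p
        ... | no  p = contradiction
          (ℚ.½ ℚ.* ε , ℚ.positive (half ε 0<ε) , N , λ n N≤n → ℚ.≮⇒≥ (λ q → p (begin-strict
            ℚ.∣ seq x m ∣                                       ≡⟨ cong ℚ.∣_∣ (minus-plus (seq x m) (seq x n)) ⟨
            ℚ.∣ (seq x m ℚ.- seq x n) ℚ.+ seq x n ∣
              ≤⟨ ℚ.∣p+q∣≤∣p∣+∣q∣ (seq x m ℚ.- seq x n) (seq x n) ⟩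
            ℚ.∣ seq x m ℚ.- seq x n ∣ ℚ.+ ℚ.∣ seq x n ∣         <⟨ ℚ.+-mono-< (close′ m n N≤m N≤n) q ⟩
            ℚ.½ ℚ.* ε ℚ.+ ℚ.½ ℚ.* ε                             ≡⟨ halves ε ⟩
            ε                                                   ∎)))
          ¬away
          where open ℚ.≤-Reasoning

    module _ (x : ℝ) (away : AwayFromZero (seq x)) where
      private
        δ = proj₁ away
        N = proj₁ (proj₂ (proj₂ away))
        δ≤ = proj₂ (proj₂ (proj₂ away))
        instance
          δ>0 : ℚ.Positive δ
          δ>0 = proj₁ (proj₂ away)
          δ≠0 : ℚ.NonZero δ
          δ≠0 = ℚ.pos⇒nonZero δ

        -- The first N terms may vanish, so they are replaced by the N-th.
        x′ : ℕ → ℚ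
        x′ n = seq x (N ℕ.⊔ n)

        x′≠0 : ∀ n → ℚ.NonZero (x′ n)
        x′≠0 n = ℚ.≢-nonZero λ x′≡0 → ≤⇒≯
          (subst (λ a → δ ℚ.≤ ℚ.∣ a ∣) x′≡0 (δ≤ (N ℕ.⊔ n) (ℕ.m≤m⊔n N n)))
          (ℚ.positive⁻¹ δ)

        y : ℕ → ℚ
        y n = ℚ.1/_ (x′ n) {{x′≠0 n}}

        x′y≡1 : ∀ n → x′ n ℚ.* y n ≡ 1ℚ
        x′y≡1 n = ℚ.*-inverseʳ (x′ n) {{x′≠0 n}}

        y-bounded : Bounded y
        y-bounded = ℚ.1/ δ , ℚ.1/pos⇒pos δ , 0 , λ n _ → ℚ.*-cancelʳ-≤-pos δ (begin
          ℚ.∣ y n ∣ ℚ.* δ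
            ≤⟨ ℚ.*-monoˡ-≤-nonNeg ℚ.∣ y n ∣ {{ℚ.∣-∣-nonNeg (y n)}} (δ≤ (N ℕ.⊔ n) (ℕ.m≤m⊔n N n)) ⟩
          ℚ.∣ y n ∣ ℚ.* ℚ.∣ x′ n ∣    ≡⟨ ℚ.∣p*q∣≡∣p∣*∣q∣ (y n) (x′ n) ⟨
          ℚ.∣ y n ℚ.* x′ n ∣          ≡⟨ cong ℚ.∣_∣ (trans (ℚ.*-comm (y n) (x′ n)) (x′y≡1 n)) ⟩
          1ℚ                          ≡⟨ ℚ.*-inverseˡ δ ⟨
          (ℚ.1/ δ) ℚ.* δ              ∎)
          where open ℚ.≤-Reasoning

        x′-diff : Null (λ m n → x′ n ℚ.- x′ m)
        x′-diff ε 0<ε = let M , p = cauchy x ε 0<ε in M , λ m n M≤m M≤n →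
          p (N ℕ.⊔ n) (N ℕ.⊔ m) (ℕ.≤-trans M≤n (ℕ.m≤n⊔m N n)) (ℕ.≤-trans M≤m (ℕ.m≤n⊔m N m))

        -- This is 1/a - 1/b = (b - a)/(ab), arranged as two bounded factors times a null sequence,
        -- which is the shape that `null-*` accepts.
        y-diff : ∀ m n → y m ℚ.* (y n ℚ.* (x′ n ℚ.- x′ m)) ≡ y m ℚ.- y n
        y-diff m n = trans (rearrange (y m) (y n) (x′ m) (x′ n))
          (trans (cong₂ (λ a b → y m ℚ.* a ℚ.- y n ℚ.* b) (x′y≡1 n) (x′y≡1 m))
            (cong₂ ℚ._-_ (ℚ.*-identityʳ (y m)) (ℚ.*-identityʳ (y n))))
          where
          open ℚSolver.+-*-Solver
          rearrange : ∀ a b c d → a ℚ.* (b ℚ.* (d ℚ.- c)) ≡ a ℚ.* (d ℚ.* b) ℚ.- b ℚ.* (c ℚ.* a)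
          rearrange = solve 4 (λ a b c d → a :* (b :* (d :- c)) := a :* (d :* b) :- b :* (c :* a)) refl

        y-cauchy : Cauchy y
        y-cauchy = null-cong _ (Δ y) y-diff
          (null-* y (λ m n → y n ℚ.* (x′ n ℚ.- x′ m)) (λ m _ → m) fst-large y-bounded
            (null-* y (λ m n → x′ n ℚ.- x′ m) (λ _ n → n) snd-large y-bounded x′-diff))

      -- From index `N` on, `x′` agrees with `seq x`, so the product equals 1 exactly and not just
      -- in the limit.
      inverse-away : ∃[ z ] x *ℝ z ≈ℝ constℝ 1ℚ
      inverse-away = mkℝ y y-cauchy , mk≈ λ ε 0<ε → N , λ n N≤n →
        subst (λ a → ℚ.∣ a ∣ ℚ.< ε)
          (sym (trans (cong (ℚ._- 1ℚ)
            (trans (cong (λ k → seq x k ℚ.* y n) (sym (ℕ.m≤n⇒m⊔n≡n N≤n))) (x′y≡1 n))) (ℚ.+-inverseʳ 1ℚ)))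
          0<ε

    ℝ-inverse : ∀ x → ¬ (x ≈ℝ constℝ 0ℚ) → ∃[ z ] x *ℝ z ≈ℝ constℝ 1ℚ
    ℝ-inverse x x≉0 = inverse-away x (nonzero⇒away x x≉0)

  module SumOfSquares where
    private
      sq : ∀ p → ℚ.∣ p ∣ ℚ.* ℚ.∣ p ∣ ≡ p ℚ.* p
      sq p with ℚ.∣p∣≡p∨∣p∣≡-p p
      ... | inj₁ e = cong₂ ℚ._*_ e e
      ... | inj₂ e = trans (cong₂ ℚ._*_ e e) (solve 1 (λ a → (:- a) :* (:- a) := a :* a) refl p)
        where open ℚSolver.+-*-Solver

    dominated : ∀ a b ε → 0ℚ ℚ.< ε → ℚ.∣ (a ℚ.* a ℚ.+ b ℚ.* b) ℚ.- 0ℚ ∣ ℚ.< ε ℚ.* ε → ℚ.∣ a ∣ ℚ.< ε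
    dominated a b ε 0<ε small = ℚ.≰⇒> λ ε≤a → ≤⇒≯ (begin
      ε ℚ.* ε                                   ≤⟨ ℚ.*-monoˡ-≤-nonNeg ε {{ℚ.nonNegative (ℚ.<⇒≤ 0<ε)}} ε≤a ⟩
      ε ℚ.* ℚ.∣ a ∣                             ≤⟨ ℚ.*-monoʳ-≤-nonNeg ℚ.∣ a ∣ {{ℚ.∣-∣-nonNeg a}} ε≤a ⟩
      ℚ.∣ a ∣ ℚ.* ℚ.∣ a ∣                       ≡⟨ ℚ.+-identityʳ _ ⟨
      ℚ.∣ a ∣ ℚ.* ℚ.∣ a ∣ ℚ.+ 0ℚ                ≤⟨ ℚ.+-monoʳ-≤ (ℚ.∣ a ∣ ℚ.* ℚ.∣ a ∣) (0≤sq b) ⟩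
      ℚ.∣ a ∣ ℚ.* ℚ.∣ a ∣ ℚ.+ ℚ.∣ b ∣ ℚ.* ℚ.∣ b ∣ ≡⟨ cong₂ ℚ._+_ (sq a) (sq b) ⟩
      a ℚ.* a ℚ.+ b ℚ.* b                       ≤⟨ p≤∣p∣ _ ⟩
      ℚ.∣ a ℚ.* a ℚ.+ b ℚ.* b ∣                 ≡⟨ cong ℚ.∣_∣ (ℚ.+-identityʳ _) ⟨
      ℚ.∣ (a ℚ.* a ℚ.+ b ℚ.* b) ℚ.- 0ℚ ∣        ∎) small
      where
      open ℚ.≤-Reasoning
      0≤sq : ∀ b → 0ℚ ℚ.≤ ℚ.∣ b ∣ ℚ.* ℚ.∣ b ∣
      0≤sq b = ℚ.nonNegative⁻¹ _ {{ℚ.nonNeg*nonNeg⇒nonNeg ℚ.∣ b ∣ {{ℚ.∣-∣-nonNeg b}} ℚ.∣ b ∣ {{ℚ.∣-∣-nonNeg b}}}}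
      p≤∣p∣ : ∀ p → p ℚ.≤ ℚ.∣ p ∣
      p≤∣p∣ p with 0ℚ ℚ.≤? p
      ... | yes 0≤p = ℚ.≤-reflexive (sym (ℚ.0≤p⇒∣p∣≡p 0≤p))
      ... | no  0≰p = ℚ.≤-trans (ℚ.<⇒≤ (ℚ.≰⇒> 0≰p)) (ℚ.0≤∣p∣ p)

    -- This stands in for an order on the reals: each term satisfies a² ≤ a² + b² in the rationals,
    -- so a bound `ε * ε` on the sum bounds `a` by `ε`.
    sum-of-squares≈0⇒≈0 : ∀ a b → a *ℝ a +ℝ b *ℝ b ≈ℝ constℝ 0ℚ → a ≈ℝ constℝ 0ℚ
    sum-of-squares≈0⇒≈0 a b a²+b²≈0 = mk≈ λ ε 0<ε →
      let N , p = close a²+b²≈0 (ε ℚ.* ε)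
            (ℚ.positive⁻¹ _ {{ℚ.pos*pos⇒pos ε {{ℚ.positive 0<ε}} ε {{ℚ.positive 0<ε}}}})
      in N , λ n N≤n → subst (λ c → ℚ.∣ c ∣ ℚ.< ε) (sym (ℚ.+-identityʳ (seq a n)))
           (dominated (seq a n) (seq b n) ε 0<ε (p n N≤n))

  module ComplexInverse where
    private
      module Identities {c ℓ : Level} (K : CommutativeRing c ℓ) where
        open CommutativeRing K renaming (refl to ≈-refl)
        open IntegerRingSolver K

        re-part : ∀ a b s → a * (a * s) + - (b * (- b * s)) ≈ (a * a + b * b) * s
        re-part = solve 3 (λ a b s → a :* (a :* s) :+ :- (b :* (:- b :* s)) := (a :* a :+ b :* b) :* s) ≈-refl

        im-part : ∀ a b s → a * (- b * s) + b * (a * s) ≈ 0#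
        im-part = solve 3 (λ a b s → a :* (:- b :* s) :+ b :* (a :* s) := con (ℤ.+ 0)) ≈-refl

      module R = CommutativeRing ℝ-commutativeRing

    ℂ-inverse : ExcludedMiddle 0ℓ → ∀ z → ¬ (z ≈ℂ 0ℂ) → ∃[ w ] z *ℂ w ≈ℂ 1ℂ
    ℂ-inverse em z@(a +i b) z≉0 =
      let s , p = RealInverse.ℝ-inverse em (a *ℝ a +ℝ b *ℝ b) λ a²+b²≈0 →
            z≉0 (sum-of-squares≈0⇒≈0 a b a²+b²≈0 +i≈
                 sum-of-squares≈0⇒≈0 b a (R.trans (R.+-comm (b *ℝ b) (a *ℝ a)) a²+b²≈0))
      -- The conjugate divided by the squared modulus; `s` is the inverse of the latter.
      in ((a *ℝ s) +i ((-ℝ b) *ℝ s)) ,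
         (R.trans (re-part a b s) p +i≈ im-part a b s)
      where
      open SumOfSquares
      open Identities ℝ-commutativeRing

    private
      module C = CommutativeRing ℂ-commutativeRing
      open RawMonoidDefs C.+-rawMonoid using () renaming (_×_ to _·_)
      open RawMonoidDefs ℚ.+-0-rawMonoid using () renaming (_×_ to _·ℚ_)

      seq-re : ∀ n k → seq (re (n · 1ℂ)) k ≡ n ·ℚ 1ℚ
      seq-re zero    k = refl
      seq-re (suc n) k = cong (1ℚ ℚ.+_) (seq-re n k)

      0≤n : ∀ n → 0ℚ ℚ.≤ n ·ℚ 1ℚ
      0≤n zero    = ℚ.≤-refl
      0≤n (suc n) = ℚ.+-mono-≤ (ℚ.nonNegative⁻¹ 1ℚ) (0≤n n)

    -- The real part of `suc n · 1ℂ` is a constant rational sequence with value at least 1, so it is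
    -- not null.
    ℂ-characteristic-zero : ∀ n → ¬ (suc n · 1ℂ ≈ℂ 0ℂ)
    ℂ-characteristic-zero n p =
      let N , q = close (re≈ p) 1ℚ (ℚ.positive⁻¹ 1ℚ) in
      ≤⇒≯ (begin
        1ℚ                                      ≡⟨ ℚ.+-identityʳ 1ℚ ⟨
        1ℚ ℚ.+ 0ℚ                               ≤⟨ ℚ.+-monoʳ-≤ 1ℚ (0≤n n) ⟩
        suc n ·ℚ 1ℚ                             ≡⟨ ℚ.0≤p⇒∣p∣≡p (0≤n (suc n)) ⟨
        ℚ.∣ suc n ·ℚ 1ℚ ∣
          ≡⟨ cong ℚ.∣_∣ (trans (ℚ.+-identityʳ (seq (re (suc n · 1ℂ)) N)) (seq-re (suc n) N)) ⟨
        ℚ.∣ seq (re (suc n · 1ℂ)) N ℚ.- 0ℚ ∣    ∎) (q N ℕ.≤-refl)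
      where open ℚ.≤-Reasoning

-- The commutative ring of Laurent polynomials

module LaurentRing where
  open ≡ using (refl; sym; trans; cong; cong₂)
  open import Data.List.Base using ([]; _∷_; _++_)
  open Laurent using (Laurent; coefficient; _+_; _*_; -_; 0#; 1#)

  -- Coefficientwise equality is not visibly a congruence for _*_; equality
  -- under all additive functionals qᵉ ↦ φ e is, and it implies the former.
  ⟨_,_⟩ : Laurent → (ℤ → ℤ) → ℤ
  ⟨ []          , φ ⟩ = + 0
  ⟨ (c , e) ∷ p , φ ⟩ = c ℤ.* φ e ℤ.+ ⟨ p , φ ⟩

  infix 4 _≋_
  record _≋_ (p s : Laurent) : Set where
    constructor mk≋
    field pairing : ∀ φ → ⟨ p , φ ⟩ ≡ ⟨ s , φ ⟩
  open _≋_ public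

  private
    open ℤSolver.+-*-Solver using (solve; _:+_; _:*_; :-_; _:=_; con)

    pairing-cong : ∀ p {φ ψ} → (∀ e → φ e ≡ ψ e) → ⟨ p , φ ⟩ ≡ ⟨ p , ψ ⟩
    pairing-cong []            φ≗ψ = refl
    pairing-cong ((c , e) ∷ p) φ≗ψ = cong₂ (λ a b → c ℤ.* a ℤ.+ b) (φ≗ψ e) (pairing-cong p φ≗ψ)

    pairing-++ : ∀ p s φ → ⟨ p ++ s , φ ⟩ ≡ ⟨ p , φ ⟩ ℤ.+ ⟨ s , φ ⟩
    pairing-++ []            s φ = sym (ℤ.+-identityˡ _)
    pairing-++ ((c , e) ∷ p) s φ = trans (cong (λ z → c ℤ.* φ e ℤ.+ z) (pairing-++ p s φ))
      (sym (ℤ.+-assoc (c ℤ.* φ e) _ _))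

    pairing-neg : ∀ p φ → ⟨ - p , φ ⟩ ≡ ℤ.- ⟨ p , φ ⟩
    pairing-neg []            φ = refl
    pairing-neg ((c , e) ∷ p) φ = trans (cong (λ z → ℤ.- c ℤ.* φ e ℤ.+ z) (pairing-neg p φ))
      (solve 3 (λ c x y → :- c :* x :+ :- y := :- (c :* x :+ y)) refl c (φ e) ⟨ p , φ ⟩)

    pairing-0 : ∀ p → ⟨ p , (λ _ → + 0) ⟩ ≡ + 0
    pairing-0 []            = refl
    pairing-0 ((c , e) ∷ p) = cong₂ ℤ._+_ (ℤ.*-zeroʳ c) (pairing-0 p)

    pairing-affine : ∀ p c φ ψ → ⟨ p , (λ e → c ℤ.* φ e ℤ.+ ψ e) ⟩ ≡ c ℤ.* ⟨ p , φ ⟩ ℤ.+ ⟨ p , ψ ⟩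
    pairing-affine []            c φ ψ = sym (trans (ℤ.+-identityʳ _) (ℤ.*-zeroʳ c))
    pairing-affine ((d , e) ∷ p) c φ ψ =
      trans (cong (λ z → d ℤ.* (c ℤ.* φ e ℤ.+ ψ e) ℤ.+ z) (pairing-affine p c φ ψ))
        (solve 6 (λ d c x y v w → d :* (c :* x :+ y) :+ (c :* v :+ w) := c :* (d :* x :+ v) :+ (d :* y :+ w))
          refl d c (φ e) (ψ e) ⟨ p , φ ⟩ ⟨ p , ψ ⟩)

    -- Interchange of two finite sums; commutativity of the product rests on it.
    pairing-swap : ∀ p s (g : ℤ → ℤ → ℤ) →
      ⟨ p , (λ e → ⟨ s , g e ⟩) ⟩ ≡ ⟨ s , (λ f → ⟨ p , (λ e → g e f) ⟩) ⟩
    pairing-swap []            s g = sym (pairing-0 s)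
    pairing-swap ((c , e) ∷ p) s g = trans (cong (λ z → c ℤ.* ⟨ s , g e ⟩ ℤ.+ z) (pairing-swap p s g))
      (sym (pairing-affine s c (g e) (λ f → ⟨ p , (λ e → g e f) ⟩)))

    pairing-monomial : ∀ c e s φ →
      ⟨ List.map (λ (d , f) → c ℤ.* d , e ℤ.+ f) s , φ ⟩ ≡ c ℤ.* ⟨ s , (λ f → φ (e ℤ.+ f)) ⟩
    pairing-monomial c e []            φ = sym (ℤ.*-zeroʳ c)
    pairing-monomial c e ((d , f) ∷ s) φ = trans (cong (λ z → c ℤ.* d ℤ.* φ (e ℤ.+ f) ℤ.+ z) (pairing-monomial c e s φ))
      (solve 4 (λ c d x y → c :* d :* x :+ c :* y := c :* (d :* x :+ y)) refl
        c d (φ (e ℤ.+ f)) ⟨ s , (λ f → φ (e ℤ.+ f)) ⟩)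

    -- An iterated pairing sees each factor only up to `_≋_`. This makes `_*_` a congruence and
    -- reduces its laws to laws for adding exponents in ℤ.
    pairing-* : ∀ p s φ → ⟨ p * s , φ ⟩ ≡ ⟨ p , (λ e → ⟨ s , (λ f → φ (e ℤ.+ f)) ⟩) ⟩
    pairing-* []            s φ = refl
    pairing-* ((c , e) ∷ p) s φ = trans (pairing-++ (List.map _ s) (p * s) φ)
      (cong₂ ℤ._+_ (pairing-monomial c e s φ) (pairing-* p s φ))

    +-cong : ∀ {p p′ s s′} → p ≋ p′ → s ≋ s′ → p + s ≋ p′ + s′
    +-cong {p} {p′} {s} {s′} a b = mk≋ λ φ → trans (pairing-++ p s φ)
      (trans (cong₂ ℤ._+_ (pairing a φ) (pairing b φ)) (sym (pairing-++ p′ s′ φ)))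

    +-comm : ∀ p s → p + s ≋ s + p
    +-comm p s = mk≋ λ φ → trans (pairing-++ p s φ) (trans (ℤ.+-comm ⟨ p , φ ⟩ ⟨ s , φ ⟩) (sym (pairing-++ s p φ)))

    neg-cong : ∀ {p s} → p ≋ s → - p ≋ - s
    neg-cong {p} {s} a = mk≋ λ φ → trans (pairing-neg p φ)
      (trans (cong ℤ.-_ (pairing a φ)) (sym (pairing-neg s φ)))

    neg-inverseˡ : ∀ p → - p + p ≋ 0#
    neg-inverseˡ p = mk≋ λ φ → trans (pairing-++ (- p) p φ)
      (trans (cong (ℤ._+ ⟨ p , φ ⟩) (pairing-neg p φ)) (ℤ.+-inverseˡ ⟨ p , φ ⟩))

    *-cong : ∀ {p p′ s s′} → p ≋ p′ → s ≋ s′ → p * s ≋ p′ * s′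
    *-cong {p} {p′} {s} {s′} a b = mk≋ λ φ → trans (pairing-* p s φ)
      (trans (pairing a _) (trans (pairing-cong p′ λ e → pairing b _) (sym (pairing-* p′ s′ φ))))

    *-comm : ∀ p s → p * s ≋ s * p
    *-comm p s = mk≋ λ φ → trans (pairing-* p s φ) (trans (pairing-swap p s _)
      (trans (pairing-cong s λ f → pairing-cong p λ e → cong φ (ℤ.+-comm e f)) (sym (pairing-* s p φ))))

    *-assoc : ∀ p s t → (p * s) * t ≋ p * (s * t)
    *-assoc p s t = mk≋ λ φ → trans (pairing-* (p * s) t φ) (trans (pairing-* p s _)
      (sym (trans (pairing-* p (s * t) φ) (pairing-cong p λ e → trans (pairing-* s t _)
        (pairing-cong s λ f → pairing-cong t λ g → cong φ (sym (ℤ.+-assoc e f g)))))))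

    *-identityˡ : ∀ p → 1# * p ≋ p
    *-identityˡ p = mk≋ λ φ → trans (pairing-* 1# p φ)
      (trans (trans (ℤ.+-identityʳ _) (ℤ.*-identityˡ _))
        (pairing-cong p λ e → cong φ (ℤ.+-identityˡ e)))

    distribʳ : ∀ p s t → (s + t) * p ≋ s * p + t * p
    distribʳ p s t = mk≋ λ φ → trans (pairing-* (s + t) p φ) (trans (pairing-++ s t _)
      (trans (sym (cong₂ ℤ._+_ (pairing-* s p φ) (pairing-* t p φ))) (sym (pairing-++ (s * p) (t * p) φ))))

    ≋-trans : ∀ {p s t} → p ≋ s → s ≋ t → p ≋ t
    ≋-trans a b = mk≋ λ φ → trans (pairing a φ) (pairing b φ)

    reflexive : ∀ {p s} → p ≡ s → p ≋ s
    reflexive refl = mk≋ λ _ → refl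

  commutativeRing : CommutativeRing 0ℓ 0ℓ
  commutativeRing = record
    { Carrier = Laurent
    ; _≈_ = _≋_
    ; _+_ = _+_
    ; _*_ = _*_
    ; -_ = -_
    ; 0# = 0#
    ; 1# = 1#
    ; isCommutativeRing = record
      { isRing = record
        { +-isAbelianGroup = record
          { isGroup = record
            { isMonoid = record
              { isSemigroup = record
                { isMagma = record
                  { isEquivalence = record
                    { refl = mk≋ λ _ → refl
                    ; sym = λ a → mk≋ λ φ → sym (pairing a φ)
                    ; trans = ≋-trans
                    }
                  ; ∙-cong = +-cong
                  }
                ; assoc = λ p s t → reflexive (List.++-assoc p s t)
                }
              ; identity = (λ p → reflexive refl) , (λ p → reflexive (List.++-identityʳ p))
              }
            ; inverse = neg-inverseˡ , λ p → ≋-trans (+-comm p (- p)) (neg-inverseˡ p)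
            ; ⁻¹-cong = neg-cong
            }
          ; comm = +-comm
          }
        ; *-cong = *-cong
        ; *-assoc = *-assoc
        ; *-identity = *-identityˡ , λ p → ≋-trans (*-comm p 1#) (*-identityˡ p)
        ; distrib = (λ p s t → ≋-trans (*-comm p (s + t)) (≋-trans (distribʳ p s t)
                      (+-cong (*-comm s p) (*-comm t p))))
                  , distribʳ
        }
      ; *-comm = *-comm
      }
    }

  -- The coefficient at `k` is the pairing with the Kronecker delta at `k`.
  ≋⇒≈ : ∀ {p s} → p ≋ s → p Laurent.≈ s
  ≋⇒≈ {p} {s} a k = trans (coefficient-pairing p) (trans (pairing a δ) (sym (coefficient-pairing s)))
    where
    δ : ℤ → ℤ
    δ e = if does (e ℤ.≟ k) then + 1 else + 0
    indicator : ∀ c b → (if b then c else + 0) ≡ c ℤ.* (if b then + 1 else + 0)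
    indicator c true  = sym (ℤ.*-identityʳ c)
    indicator c false = sym (ℤ.*-zeroʳ c)
    coefficient-pairing : ∀ p → coefficient p k ≡ ⟨ p , δ ⟩
    coefficient-pairing []            = refl
    coefficient-pairing ((c , e) ∷ p) = cong₂ ℤ._+_ (indicator c (does (e ℤ.≟ k))) (coefficient-pairing p)

-- Deletion-contraction for the subset sum and for truncated series

shift : (ℕ → ℕ) → ℕ → ℕ
shift d zero    = 0
shift d (suc i) = d i

constant : ℕ → ℕ
constant zero    = 1
constant (suc _) = 0

-- The operations of R come with two equalities, the one of R and the finer _≋_;
-- R stays abstract, so that products of Laurent polynomials are not unfolded.
module TutteRecursion {c ℓ ℓ′ : Level} (R : RawRing c ℓ) (_≋_ : Rel (RawRing.Carrier R) ℓ′)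
  (isCommutativeRing : IsCommutativeRing _≋_
    (RawRing._+_ R) (RawRing._*_ R) (RawRing.-_ R) (RawRing.0# R) (RawRing.1# R))
  (q q⁻¹ : RawRing.Carrier R) (qq⁻¹≋1 : (RawRing._*_ R q q⁻¹) ≋ (RawRing.1# R)) where

  open ≡ using (refl; sym; trans; cong; cong₂)
  open import Data.List.Base using ([]; _∷_; _++_)
  open RawRing R hiding (_≈_)

  private
    commutativeRing : CommutativeRing c ℓ′
    commutativeRing = record { isCommutativeRing = isCommutativeRing }

  open CommutativeRing commutativeRing
    using (_≈_; setoid; semiring; _-_; +-cong; +-congˡ; +-congʳ; *-cong; *-congˡ; *-congʳ;
           +-identityˡ; +-identityʳ; *-identityˡ; *-identityʳ; +-assoc; *-assoc; zeroʳ; distribˡ)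
    renaming (refl to ≈-refl; sym to ≈-sym; trans to ≈-trans; reflexive to ≈-reflexive)
  open RawSemiringDefs rawSemiring using (_^_; sum) renaming (_×_ to _·_)
  import Algebra.Properties.Semiring.Sum semiring as Sum
  import Algebra.Properties.Semiring.Mult semiring as Mult
  open IntegerRingSolver commutativeRing using (solve; _:+_; _:*_; :-_; _:=_; con)
  open import Relation.Binary.Reasoning.Setoid setoid

  private
    sum≡ : ∀ {n} (v : Vector Carrier n) → sum v ≡ Sum.sum v
    sum≡ {zero}  v = refl
    sum≡ {suc n} v = cong (λ z → v zero + z) (sum≡ (v ∘ suc))

    ·≡ : ∀ n p → n · p ≡ n Mult.× p
    ·≡ zero    p = refl
    ·≡ (suc n) p = cong (λ z → p + z) (·≡ n p)

    ^-cong : ∀ {p s} n → p ≈ s → p ^ n ≈ s ^ n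
    ^-cong zero    a = ≈-refl
    ^-cong (suc n) a = *-cong a (^-cong n a)

    ^-+ : ∀ p m n → p ^ (m ℕ.+ n) ≈ p ^ m * p ^ n
    ^-+ p zero    n = ≈-sym (*-identityˡ _)
    ^-+ p (suc m) n = ≈-trans (*-congˡ (^-+ p m n)) (≈-sym (*-assoc p _ _))

    *-^ : ∀ p s n → p ^ n * s ^ n ≈ (p * s) ^ n
    *-^ p s zero    = *-identityˡ _
    *-^ p s (suc n) = ≈-trans
      (solve 4 (λ a b c d → (a :* b) :* (c :* d) := (a :* c) :* (b :* d)) ≈-refl p (p ^ n) s (s ^ n))
      (*-congˡ (*-^ p s n))

    Σₗ : ∀ {A : Set} → (A → Carrier) → List A → Carrier
    Σₗ f xs = List.foldr _+_ 0# (List.map f xs)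

    module _ {A : Set} where
      Σₗ-cong : ∀ {f g : A → Carrier} xs → (∀ x → f x ≈ g x) → Σₗ f xs ≈ Σₗ g xs
      Σₗ-cong []       f≋g = ≈-refl
      Σₗ-cong (x ∷ xs) f≋g = +-cong (f≋g x) (Σₗ-cong xs f≋g)

      Σₗ-++ : ∀ (f : A → Carrier) xs ys → Σₗ f (xs ++ ys) ≈ Σₗ f xs + Σₗ f ys
      Σₗ-++ f []       ys = ≈-sym (+-identityˡ _)
      Σₗ-++ f (x ∷ xs) ys = ≈-trans (+-congˡ (Σₗ-++ f xs ys)) (≈-sym (+-assoc (f x) _ _))

      Σₗ-* : ∀ p (f : A → Carrier) xs → p * Σₗ f xs ≈ Σₗ (λ x → p * f x) xs
      Σₗ-* p f []       = zeroʳ p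
      Σₗ-* p f (x ∷ xs) = ≈-trans (distribˡ p (f x) _) (+-congˡ (Σₗ-* p f xs))

    Σₗ-map : ∀ {A B : Set} (f : B → Carrier) (h : A → B) xs → Σₗ f (List.map h xs) ≡ Σₗ (f ∘ h) xs
    Σₗ-map f h []       = refl
    Σₗ-map f h (x ∷ xs) = cong (λ z → f (h x) + z) (Σₗ-map f h xs)

    Σₗ-subsets : ∀ {n} (f : Subset (suc n) → Carrier) → Σₗ f (subsets (suc n)) ≈
      Σₗ (λ S → f (outside Vec.∷ S)) (subsets n) + Σₗ (λ S → f (inside Vec.∷ S)) (subsets n)
    Σₗ-subsets {n} f = ≈-trans (Σₗ-++ f (List.map _ (subsets n)) (List.map _ (subsets n)))
      (+-cong (≈-reflexive (Σₗ-map f _ (subsets n))) (≈-reflexive (Σₗ-map f _ (subsets n))))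

  -- q^(n-r) T(1+q,1/q) for a matroid with rank function ρ; the rank r cancels.
  euler : ∀ {n} → (Subset n → ℕ) → Carrier
  euler {n} ρ = Σₗ (λ S → q ^ (n ∸ ∣ S ∣) * (1# - q) ^ (∣ S ∣ ∸ ρ S)) (subsets n)

  private
    -- Of the exponents n - r, r - k and s - k of q, the power s - k is absorbed
    -- by (1/q - 1)^(s-k) and n - s remains.
    term-euler : ∀ n r s k → k ℕ.≤ r → r ℕ.≤ n → k ℕ.≤ s → s ℕ.≤ n →
      q ^ (n ∸ r) * ((1# + q - 1#) ^ (r ∸ k) * (q⁻¹ - 1#) ^ (s ∸ k)) ≈ q ^ (n ∸ s) * (1# - q) ^ (s ∸ k)
    term-euler n r s k k≤r r≤n k≤s s≤n = begin
      q ^ (n ∸ r) * ((1# + q - 1#) ^ (r ∸ k) * (q⁻¹ - 1#) ^ (s ∸ k))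
        ≈⟨ *-congˡ (*-congʳ (^-cong (r ∸ k) (solve 1 (λ x → con (+ 1) :+ x :+ :- con (+ 1) := x) ≈-refl q))) ⟩
      q ^ (n ∸ r) * (q ^ (r ∸ k) * (q⁻¹ - 1#) ^ (s ∸ k))
        ≈⟨ *-assoc _ _ _ ⟨
      q ^ (n ∸ r) * q ^ (r ∸ k) * (q⁻¹ - 1#) ^ (s ∸ k)
        ≈⟨ *-congʳ (≈-sym (^-+ q (n ∸ r) (r ∸ k))) ⟩
      q ^ ((n ∸ r) ℕ.+ (r ∸ k)) * (q⁻¹ - 1#) ^ (s ∸ k)
        ≡⟨ cong (λ e → q ^ e * (q⁻¹ - 1#) ^ (s ∸ k)) exponents ⟩
      q ^ ((n ∸ s) ℕ.+ (s ∸ k)) * (q⁻¹ - 1#) ^ (s ∸ k)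
        ≈⟨ *-congʳ (^-+ q (n ∸ s) (s ∸ k)) ⟩
      q ^ (n ∸ s) * q ^ (s ∸ k) * (q⁻¹ - 1#) ^ (s ∸ k)
        ≈⟨ *-assoc _ _ _ ⟩
      q ^ (n ∸ s) * (q ^ (s ∸ k) * (q⁻¹ - 1#) ^ (s ∸ k))
        ≈⟨ *-congˡ (*-^ q (q⁻¹ - 1#) (s ∸ k)) ⟩
      q ^ (n ∸ s) * (q * (q⁻¹ - 1#)) ^ (s ∸ k)
        ≈⟨ *-congˡ (^-cong (s ∸ k) (solve 2 (λ x y → x :* (y :+ :- con (+ 1)) := x :* y :+ :- x) ≈-refl q q⁻¹)) ⟩
      q ^ (n ∸ s) * (q * q⁻¹ - q) ^ (s ∸ k)
        ≈⟨ *-congˡ (^-cong (s ∸ k) (+-congʳ qq⁻¹≋1)) ⟩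
      q ^ (n ∸ s) * (1# - q) ^ (s ∸ k) ∎
      where
      telescope : ∀ {a b c} → c ℕ.≤ b → b ℕ.≤ a → (a ∸ b) ℕ.+ (b ∸ c) ≡ a ∸ c
      telescope {a} {b} {c} c≤b b≤a = trans (sym (ℕ.+-∸-assoc (a ∸ b) c≤b)) (cong (_∸ c) (ℕ.m∸n+n≡m b≤a))
      exponents : (n ∸ r) ℕ.+ (r ∸ k) ≡ (n ∸ s) ℕ.+ (s ∸ k)
      exponents = trans (telescope k≤r r≤n) (sym (telescope k≤s s≤n))

  -- The inequalities between `ρ`, `r`, `n` and the sizes make every truncated difference in the
  -- exponents a true difference, so the identity holds term by term.
  tutte-euler : ∀ {n} (ρ : Subset n → ℕ) r → r ℕ.≤ n → (∀ S → ρ S ℕ.≤ r) → (∀ S → ρ S ℕ.≤ ∣ S ∣) →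
    q ^ (n ∸ r) * List.foldr _+_ 0# (List.map
      (λ S → (1# + q - 1#) ^ (r ∸ ρ S) * (q⁻¹ - 1#) ^ (∣ S ∣ ∸ ρ S)) (subsets n)) ≈ euler ρ
  tutte-euler {n} ρ r r≤n ρ≤r ρ≤∣∣ = ≈-trans (Σₗ-* (q ^ (n ∸ r)) _ (subsets n))
    (Σₗ-cong (subsets n) λ S → term-euler n r ∣ S ∣ (ρ S) (ρ≤r S) r≤n (ρ≤∣∣ S) (∣p∣≤n S))

  private
    euler-outside : ∀ {n} (ρ : Subset (suc n) → ℕ) (ρ₁ : Subset n → ℕ) →
      (∀ S → ρ (outside Vec.∷ S) ≡ ρ₁ S) → ∀ S →
      q ^ (suc n ∸ ∣ S ∣) * (1# - q) ^ (∣ S ∣ ∸ ρ (outside Vec.∷ S)) ≈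
      q * (q ^ (n ∸ ∣ S ∣) * (1# - q) ^ (∣ S ∣ ∸ ρ₁ S))
    euler-outside ρ ρ₁ h S = ≈-trans
      (≈-reflexive (cong₂ (λ a b → q ^ a * (1# - q) ^ (∣ S ∣ ∸ b)) (ℕ.+-∸-assoc 1 (∣p∣≤n S)) (h S)))
      (*-assoc q _ _)

  -- Omitting the loop contributes a factor `q`. Including it raises the size but not the rank and
  -- contributes `1# - q`. The two factors add up to 1.
  euler-loop : ∀ {n} (ρ : Subset (suc n) → ℕ) (ρ₁ : Subset n → ℕ) → (∀ S → ρ₁ S ℕ.≤ ∣ S ∣) →
    (∀ S → ρ (outside Vec.∷ S) ≡ ρ₁ S) → (∀ S → ρ (inside Vec.∷ S) ≡ ρ₁ S) → euler ρ ≈ euler ρ₁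
  euler-loop {n} ρ ρ₁ ρ₁≤∣∣ out ins = begin
    euler ρ
      ≈⟨ Σₗ-subsets {n} _ ⟩
    _ ≈⟨ +-cong (Σₗ-cong (subsets n) (euler-outside ρ ρ₁ out)) (Σₗ-cong (subsets n) λ S →
           ≈-trans (≈-reflexive (cong (λ a → q ^ (n ∸ ∣ S ∣) * (1# - q) ^ a)
             (trans (cong (suc ∣ S ∣ ∸_) (ins S)) (ℕ.+-∸-assoc 1 (ρ₁≤∣∣ S)))))
           (solve 3 (λ a b c → a :* (b :* c) := b :* (a :* c)) ≈-refl (q ^ (n ∸ ∣ S ∣)) (1# - q) _)) ⟩
    _ ≈⟨ +-cong (Σₗ-* q _ (subsets n)) (Σₗ-* (1# - q) _ (subsets n)) ⟨
    q * euler ρ₁ + (1# - q) * euler ρ₁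
      ≈⟨ solve 2 (λ x e → x :* e :+ (con (+ 1) :+ :- x) :* e := e) ≈-refl q (euler ρ₁) ⟩
    euler ρ₁ ∎

  -- Including the element raises size and rank together, so the exponent of `1# - q` is that of the
  -- contraction and no extra `q` appears; omitting it costs one factor `q`.
  euler-nonloop : ∀ {n} (ρ : Subset (suc n) → ℕ) (ρ₁ ρ₂ : Subset n → ℕ) →
    (∀ S → ρ (outside Vec.∷ S) ≡ ρ₁ S) → (∀ S → ρ (inside Vec.∷ S) ≡ suc (ρ₂ S)) →
    euler ρ ≈ q * euler ρ₁ + euler ρ₂
  euler-nonloop {n} ρ ρ₁ ρ₂ out ins = begin
    euler ρ
      ≈⟨ Σₗ-subsets {n} _ ⟩
    _ ≈⟨ +-cong (Σₗ-cong (subsets n) (euler-outside ρ ρ₁ out)) (Σₗ-cong (subsets n) λ S →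
           ≈-reflexive (cong (λ a → q ^ (n ∸ ∣ S ∣) * (1# - q) ^ (suc ∣ S ∣ ∸ a)) (ins S))) ⟩
    _ ≈⟨ +-congʳ (Σₗ-* q _ (subsets n)) ⟨
    q * euler ρ₁ + euler ρ₂ ∎

  series : ℕ → (ℕ → ℕ) → Carrier
  series N d = sum {N} (λ i → d (toℕ i) · (q ^ toℕ i))

  series-+ : ∀ N c d → series N (λ i → c i ℕ.+ d i) ≈ series N c + series N d
  series-+ N c d = begin
    series N (λ i → c i ℕ.+ d i)
      ≡⟨ sum≡ {N} _ ⟩
    Sum.sum {N} (λ i → (c (toℕ i) ℕ.+ d (toℕ i)) · (q ^ toℕ i))
      ≈⟨ Sum.sum-cong-≋ {N} (λ i → ≈-trans (≈-reflexive (·≡ (c (toℕ i) ℕ.+ d (toℕ i)) _))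
           (≈-trans (Mult.×-homo-+ (q ^ toℕ i) (c (toℕ i)) (d (toℕ i)))
             (≈-sym (≈-reflexive (cong₂ _+_ (·≡ (c (toℕ i)) _) (·≡ (d (toℕ i)) _)))))) ⟩
    Sum.sum {N} (λ i → c (toℕ i) · (q ^ toℕ i) + d (toℕ i) · (q ^ toℕ i))
      ≈⟨ Sum.∑-distrib-+ {N} _ _ ⟩
    Sum.sum {N} (λ i → c (toℕ i) · (q ^ toℕ i)) + Sum.sum {N} (λ i → d (toℕ i) · (q ^ toℕ i))
      ≡⟨ cong₂ _+_ (sum≡ {N} _) (sum≡ {N} _) ⟨
    series N c + series N d ∎

  series-shift : ∀ N d → series (suc N) (shift d) ≈ q * series N d
  series-shift N d = begin
    series (suc N) (shift d)
      ≈⟨ +-identityˡ _ ⟩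
    sum {N} (λ i → d (toℕ i) · (q * q ^ toℕ i))
      ≡⟨ sum≡ {N} _ ⟩
    Sum.sum {N} (λ i → d (toℕ i) · (q * q ^ toℕ i))
      ≈⟨ Sum.sum-cong-≋ {N} (λ i → ≈-trans (≈-reflexive (·≡ (d (toℕ i)) _))
           (≈-trans (≈-sym (Mult.×-comm-* (d (toℕ i)) q _)) (*-congˡ (≈-reflexive (sym (·≡ (d (toℕ i)) _)))))) ⟩
    Sum.sum {N} (λ i → q * (d (toℕ i) · (q ^ toℕ i)))
      ≈⟨ Sum.*-distribˡ-sum {N} q _ ⟨
    q * Sum.sum {N} (λ i → d (toℕ i) · (q ^ toℕ i))
      ≡⟨ cong (λ z → q * z) (sum≡ {N} _) ⟨
    q * series N d ∎

  series-constant : ∀ N → series (suc N) constant ≈ 1#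
  series-constant N = ≈-trans (+-congˡ (≈-trans (≈-reflexive (sum≡ {N} _)) (Sum.sum-replicate-zero N)))
    (≈-trans (+-identityʳ _) (+-identityʳ _))

  euler-[] : (ρ : Subset 0 → ℕ) → euler ρ ≈ 1#
  euler-[] ρ = ≈-trans (+-identityʳ _) (≈-trans (*-identityˡ _)
    (≈-reflexive (cong ((1# - q) ^_) (ℕ.0∸n≡0 (ρ Vec.[])))))

  -- Multiplication by `q` lengthens a truncated series by one term, hence `N` for `d` but `suc N`
  -- for `e`.
  series-recursion : ∀ N d e {p s} → series N d ≈ p → series (suc N) e ≈ s →
    series (suc N) (λ i → shift d i ℕ.+ e i) ≈ q * p + s
  series-recursion N d e series-d series-e = ≈-trans (series-+ (suc N) (shift d) e)
    (+-cong (≈-trans (series-shift N d) (*-congˡ series-d)) series-e)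

-- Linear algebra over a field: exchange, rank and contraction

module _ (K : CommutativeRing 0ℓ 0ℓ) where
  open CommutativeRing K using (_≈_; _*_; 0#; 1#; rawRing)
  open RawSemiringDefs (RawRing.rawSemiring rawRing) using () renaming (_×_ to _·_)

  Nontrivial HasInverses CharacteristicZero : Set
  Nontrivial         = ¬ (1# ≈ 0#)
  HasInverses        = ∀ x → ¬ (x ≈ 0#) → ∃[ y ] x * y ≈ 1#
  CharacteristicZero = ∀ n → ¬ (suc n · 1# ≈ 0#)

module FieldLinearAlgebra (em : ∀ {ℓ} → ExcludedMiddle ℓ) (K : CommutativeRing 0ℓ 0ℓ)
  (inverse : HasInverses K) (1≉0 : Nontrivial K) where

  open CommutativeRing K hiding (zero; _-_)
  open import Data.Vec.Functional using (_∷_; replicate)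
  open import Algebra.Properties.Semiring.Sum semiring
  open IntegerRingSolver K using (solve; _:+_; _:*_; :-_; _:=_; con)
  open import Relation.Binary.Reasoning.Setoid setoid

  private
    infixl 5 _-_
    _-_ : ∀ {n} → Subset n → Fin n → Subset n
    T - i = T Vec.[ i ]≔ outside

    i∉T-i : ∀ {n} (T : Subset n) i → i ∉ T - i
    i∉T-i (_ Vec.∷ T) (suc i) (there p) = i∉T-i T i p

    T-i⊆T : ∀ {n} (T : Subset n) i → T - i ⊆ T
    T-i⊆T (_ Vec.∷ T) zero    (there p) = there p
    T-i⊆T (_ Vec.∷ T) (suc i) here      = here
    T-i⊆T (_ Vec.∷ T) (suc i) (there p) = there (T-i⊆T T i p)

    ∣T∣≤1+∣T-i∣ : ∀ {n} (T : Subset n) i → ∣ T ∣ ℕ.≤ suc ∣ T - i ∣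
    ∣T∣≤1+∣T-i∣ (outside Vec.∷ T) zero    = ℕ.n≤1+n ∣ T ∣
    ∣T∣≤1+∣T-i∣ (inside  Vec.∷ T) zero    = ℕ.≤-refl
    ∣T∣≤1+∣T-i∣ (outside Vec.∷ T) (suc i) = ∣T∣≤1+∣T-i∣ T i
    ∣T∣≤1+∣T-i∣ (inside  Vec.∷ T) (suc i) = s≤s (∣T∣≤1+∣T-i∣ T i)

  ≈-dec : ∀ x → ¬ ¬ (x ≈ 0#) → x ≈ 0#
  ≈-dec x = em⇒dne em

  domain : ∀ {x y} → ¬ (x ≈ 0#) → x * y ≈ 0# → y ≈ 0#
  domain {x} {y} x≉0 xy≈0 = let z , xz≈1 = inverse x x≉0 in begin
    y              ≈⟨ *-identityˡ y ⟨
    1# * y         ≈⟨ *-congʳ xz≈1 ⟨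
    x * z * y      ≈⟨ solve 3 (λ x y z → x :* z :* y := z :* (x :* y)) refl x y z ⟩
    z * (x * y)    ≈⟨ *-congˡ xy≈0 ⟩
    z * 0#         ≈⟨ zeroʳ z ⟩
    0#             ∎

  sum-0 : ∀ {n} {f : Vector Carrier n} → (∀ i → f i ≈ 0#) → sum f ≈ 0#
  sum-0 {n} f≈0 = trans (sum-cong-≋ {n} f≈0) (sum-replicate-zero n)

  sum-linear : ∀ {n} a b (f g : Vector Carrier n) →
    sum (λ i → a * f i + b * g i) ≈ a * sum f + b * sum g
  sum-linear {n} a b f g = trans (∑-distrib-+ {n} _ _) (sym (+-cong (*-distribˡ-sum {n} a f) (*-distribˡ-sum {n} b g)))

  indicator : ∀ {n} → Fin n → Vector Carrier n
  indicator zero    = 1# ∷ replicate _ 0#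
  indicator (suc i) = 0# ∷ indicator i

  sum-indicator : ∀ {n} (i : Fin n) (f : Vector Carrier n) → sum (λ j → indicator i j * f j) ≈ f i
  sum-indicator {suc n} zero f = begin
    1# * f zero + sum (λ j → 0# * f (suc j))   ≈⟨ +-cong (*-identityˡ _) (sum-0 {n} (λ j → zeroˡ (f (suc j)))) ⟩
    f zero + 0#                                ≈⟨ +-identityʳ _ ⟩
    f zero                                     ∎
  sum-indicator (suc i) f = trans (+-cong (zeroˡ _) (sum-indicator i (f ∘ suc))) (+-identityˡ _)

  Supported : ∀ {n} → Subset n → Vector Carrier n → Set
  Supported T c = ∀ i → i ∉ T → c i ≈ 0#

  supported-tail : ∀ {n s} {T : Subset n} {c} → Supported (s Vec.∷ T) c → Supported T (c ∘ suc)
  supported-tail supp i i∉T = supp (suc i) (i∉T ∘ drop-there)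

  supported-outside : ∀ {n} {T : Subset n} {c a} → a ≈ 0# → Supported T c → Supported (outside Vec.∷ T) (a ∷ c)
  supported-outside a≈0 supp zero    _ = a≈0
  supported-outside a≈0 supp (suc i) p = supp i (p ∘ there)

  supported-inside : ∀ {n} {T : Subset n} {c} a → Supported T c → Supported (inside Vec.∷ T) (a ∷ c)
  supported-inside a supp zero    p = contradiction here p
  supported-inside a supp (suc i) p = supp i (p ∘ there)

  -- Gaussian elimination, by recursion on the rows in `T`. A vanishing row is a relation by itself;
  -- otherwise it has a pivot, and both its row and its column are removed, which preserves the
  -- surplus of rows over columns.
  nontrivial-relation : ∀ {n r} (T : Subset n) (M : Fin n → Fin r → Carrier) → r ℕ.< ∣ T ∣ →
    ∃[ c ] Supported T c × (∃[ i ] ¬ (c i ≈ 0#)) × (∀ j → sum (λ i → c i * M i j) ≈ 0#)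
  nontrivial-relation Vec.[] M ()
  nontrivial-relation (outside Vec.∷ T) M r<T =
    let c , supp , (i , cᵢ≉0) , relation = nontrivial-relation T (M ∘ suc) r<T in
    0# ∷ c , supported-outside refl supp , (suc i , cᵢ≉0) ,
    λ j → trans (+-cong (zeroˡ _) (relation j)) (+-identityˡ _)
  nontrivial-relation {suc n} {r} (inside Vec.∷ T) M r<T with em {P = ∃[ j ] ¬ (M zero j ≈ 0#)}
  ... | no  none = indicator zero , supp , (zero , 1≉0) ,
    λ j → trans (sum-indicator zero (λ i → M i j)) (≈-dec _ (λ M₀ⱼ≉0 → none (j , M₀ⱼ≉0)))
    where
    supp : Supported (inside Vec.∷ T) (indicator zero)
    supp zero    p = contradiction here p
    supp (suc i) p = refl
  nontrivial-relation {suc n} {suc r} (inside Vec.∷ T) M (s≤s r<T) | yes (j , pivot≉0) =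
    (c₀ ∷ c) , supported-inside c₀ supp , (suc i , cᵢ≉0) , relation
    where
    y = proj₁ (inverse (M zero j) pivot≉0)
    pivot*y≈1 = proj₂ (inverse (M zero j) pivot≉0)
    -- The other rows, with column `j` cleared by the pivot row. The recursion sees them without
    -- that column.
    N : Fin n → Fin (suc r) → Carrier
    N i k = M (suc i) k + - (M (suc i) j * y) * M zero k
    reduced = nontrivial-relation T (λ i k → N i (punchIn j k)) r<T
    c = proj₁ reduced
    supp = proj₁ (proj₂ reduced)
    i = proj₁ (proj₁ (proj₂ (proj₂ reduced)))
    cᵢ≉0 = proj₂ (proj₁ (proj₂ (proj₂ reduced)))
    -- The coefficient that the pivot row acquires when every `N i` is expanded.
    c₀ = sum (λ i → c i * - (M (suc i) j * y))

    N-relation : ∀ k → sum (λ i → c i * N i k) ≈ 0#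
    N-relation k with j Fin.≟ k
    ... | yes ≡.refl = sum-0 {n} λ i → begin
      c i * (M (suc i) j + - (M (suc i) j * y) * M zero j)
        ≈⟨ solve 4 (λ c m y p → c :* (m :+ :- (m :* y) :* p) := c :* (m :+ :- (m :* (p :* y))))
             refl (c i) (M (suc i) j) y (M zero j) ⟩
      c i * (M (suc i) j + - (M (suc i) j * (M zero j * y)))
        ≈⟨ *-congˡ (+-congˡ (-‿cong (*-congˡ pivot*y≈1))) ⟩
      c i * (M (suc i) j + - (M (suc i) j * 1#))
        ≈⟨ solve 2 (λ c m → c :* (m :+ :- (m :* con (+ 1))) := con (+ 0)) refl (c i) (M (suc i) j) ⟩
      0# ∎
    ... | no  j≢k = trans
      (reflexive (≡.cong (λ k → sum (λ i → c i * N i k)) (≡.sym (Fin.punchIn-punchOut j≢k))))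
      (proj₂ (proj₂ (proj₂ reduced)) (punchOut j≢k))

    relation : ∀ k → sum (λ i → (c₀ ∷ c) i * M i k) ≈ 0#
    relation k = begin
      c₀ * M zero k + sum (λ i → c i * M (suc i) k)
        ≈⟨ +-congʳ (*-distribʳ-sum {n} (M zero k) _) ⟩
      sum (λ i → c i * - (M (suc i) j * y) * M zero k) + sum (λ i → c i * M (suc i) k)
        ≈⟨ ∑-distrib-+ {n} _ _ ⟨
      sum (λ i → c i * - (M (suc i) j * y) * M zero k + c i * M (suc i) k)
        ≈⟨ sum-cong-≋ {n} (λ i → solve 4 (λ c a m p → c :* a :* p :+ c :* m := c :* (m :+ a :* p)) refl
             (c i) (- (M (suc i) j * y)) (M (suc i) k) (M zero k)) ⟩
      sum (λ i → c i * N i k)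
        ≈⟨ N-relation k ⟩
      0# ∎

  module _ {x : Level} {X : Set x} where
    combination : ∀ {n} → Vector Carrier n → Vector (X → Carrier) n → X → Carrier
    combination c v p = sum (λ i → c i * v i p)

    IndependentOn : ∀ {n} → Subset n → Vector (X → Carrier) n → Set x
    IndependentOn T v = ∀ c → Supported T c → (∀ p → combination c v p ≈ 0#) → ∀ i → c i ≈ 0#

    -- The coordinates of the `v i` with respect to `w` form a matrix with `r` columns, and a
    -- relation between its rows is a relation between the `v i`.
    steinitz : ∀ {n r} (T : Subset n) (v : Vector (X → Carrier) n) (w : Vector (X → Carrier) r) →
      (∀ i → ∃[ a ] ∀ p → v i p ≈ combination a w p) → IndependentOn T v → ∣ T ∣ ℕ.≤ r
    steinitz {n} {r} T v w spanned indep = ℕ.≮⇒≥ λ r<T →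
      let a = proj₁ ∘ spanned
          c , supp , (i , cᵢ≉0) , relation = nontrivial-relation T a r<T
      in cᵢ≉0 (indep c supp (λ p → begin
        sum (λ i → c i * v i p)
          ≈⟨ sum-cong-≋ {n} (λ i → trans (*-congˡ (proj₂ (spanned i) p)) (*-distribˡ-sum {r} (c i) _)) ⟩
        sum (λ i → sum (λ j → c i * (a i j * w j p)))
          ≈⟨ ∑-comm {n} {r} _ ⟩
        sum (λ j → sum (λ i → c i * (a i j * w j p)))
          ≈⟨ sum-cong-≋ {r} (λ j → trans (sum-cong-≋ {n} (λ i → sym (*-assoc (c i) (a i j) (w j p))))
               (trans (sym (*-distribʳ-sum {n} (w j p) _)) (trans (*-congʳ (relation j)) (zeroˡ _)))) ⟩
        sum {r} (λ j → 0#)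
          ≈⟨ sum-0 {r} (λ _ → refl) ⟩
        0# ∎) i)

    independentOn-outside : ∀ {n T} {v : Vector (X → Carrier) (suc n)} →
      IndependentOn T (v ∘ suc) → IndependentOn (outside Vec.∷ T) v
    independentOn-outside {n} {T} {v} indep c supp vanish = λ
      { zero    → c₀≈0
      ; (suc i) → indep (c ∘ suc) (supported-tail supp) (λ p → begin
          combination (c ∘ suc) (v ∘ suc) p  ≈⟨ +-identityˡ _ ⟨
          0# + _                             ≈⟨ +-congʳ (trans (*-congʳ c₀≈0) (zeroˡ _)) ⟨
          combination c v p                  ≈⟨ vanish p ⟩
          0#                                 ∎) i
      }
      where
      c₀≈0 = supp zero λ ()

    outside-independentOn : ∀ {n T} {v : Vector (X → Carrier) (suc n)} →
      IndependentOn (outside Vec.∷ T) v → IndependentOn T (v ∘ suc)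
    outside-independentOn indep c supp vanish i =
      indep (0# ∷ c) (supported-outside refl supp)
        (λ p → trans (+-cong (zeroˡ _) (vanish p)) (+-identityˡ _)) (suc i)

    -- A characterisation of the rank instead of its value: by uniqueness, ranks can be compared
    -- without computing with the maximum over a filtered list.
    IsRank : ∀ {n} → Vector (X → Carrier) n → Subset n → ℕ → Set x
    IsRank v S r = (∃[ T ] T ⊆ S × IndependentOn T v × ∣ T ∣ ≡ r) ×
                   (∀ T → T ⊆ S → IndependentOn T v → ∣ T ∣ ℕ.≤ r)

    isRank-unique : ∀ {n} {v : Vector (X → Carrier) n} {S r s} → IsRank v S r → IsRank v S s → r ≡ s
    isRank-unique ((T , T⊆S , indT , ≡.refl) , max-r) ((U , U⊆S , indU , ≡.refl) , max-s) =
      ℕ.≤-antisym (max-s T T⊆S indT) (max-r U U⊆S indU)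

    isRank-outside : ∀ {n} {v : Vector (X → Carrier) (suc n)} {S r} →
      IsRank (v ∘ suc) S r → IsRank v (outside Vec.∷ S) r
    isRank-outside {v = v} ((T , T⊆S , indep , ∣T∣≡r) , maximal) =
      (outside Vec.∷ T , out⊆ T⊆S , independentOn-outside {v = v} indep , ∣T∣≡r) ,
      λ { (outside Vec.∷ U) U⊆S ind → maximal U (drop-∷-⊆ U⊆S) (outside-independentOn {v = v} ind)
        ; (inside  Vec.∷ U) U⊆S ind → contradiction (U⊆S here) λ () }

    isRank-loop : ∀ {n} {v : Vector (X → Carrier) (suc n)} {S r} → (∀ p → v zero p ≈ 0#) →
      IsRank (v ∘ suc) S r → IsRank v (inside Vec.∷ S) r
    isRank-loop {n} {v} loop ((T , T⊆S , indep , ∣T∣≡r) , maximal) =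
      (outside Vec.∷ T , out⊆ T⊆S , independentOn-outside {v = v} indep , ∣T∣≡r) ,
      λ { (outside Vec.∷ U) U⊆S ind → maximal U (drop-∷-⊆ U⊆S) (outside-independentOn {v = v} ind)
        -- A set containing the loop satisfies the relation that consists of the loop alone.
        ; (inside  Vec.∷ U) U⊆S ind → contradiction
            (ind (indicator zero)
              (supported-inside 1# (λ _ _ → refl))
              (λ p → trans (sum-indicator zero (λ i → v i p)) (loop p)) zero) 1≉0 }

    -- If v₀ takes the value 1 at u, then contraction by v₀ is realised by
    -- restricting to the kernel of v₀ along u.
    module Contraction {n : ℕ} (v : Vector (X → Carrier) (suc n)) (u : X) (v₀u≈1 : v zero u ≈ 1#)
      (v/ : Vector (X → Carrier) n) (contract : ∀ i p → v/ i p ≈ v (suc i) p + - (v zero p * v (suc i) u))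
      where

      combination-contract : ∀ c p →
        combination c v/ p ≈ combination c (v ∘ suc) p + - (v zero p * combination c (v ∘ suc) u)
      combination-contract c p = begin
        sum (λ i → c i * v/ i p)
          ≈⟨ sum-cong-≋ {n} (λ i → trans (*-congˡ (contract i p))
               (solve 4 (λ c a l b → c :* (a :+ :- (l :* b)) := con (+ 1) :* (c :* a) :+ :- l :* (c :* b)) refl
                 (c i) (v (suc i) p) (v zero p) (v (suc i) u))) ⟩
        sum (λ i → 1# * (c i * v (suc i) p) + - v zero p * (c i * v (suc i) u))
          ≈⟨ sum-linear {n} 1# (- v zero p) _ _ ⟩
        1# * combination c (v ∘ suc) p + - v zero p * combination c (v ∘ suc) u
          ≈⟨ solve 3 (λ a l b → con (+ 1) :* a :+ :- l :* b := a :+ :- (l :* b)) refl _ _ _ ⟩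
        combination c (v ∘ suc) p + - (v zero p * combination c (v ∘ suc) u) ∎

      -- Contraction sends `v zero` to zero, so the tail of a relation of `v` is a relation of `v/`
      -- and must vanish. The remaining coefficient is then read off at `u`.
      independentOn-inside : ∀ {T} → IndependentOn T v/ → IndependentOn (inside Vec.∷ T) v
      independentOn-inside indep c supp vanish = λ { zero → c₀≈0 ; (suc i) → tail≈0 i }
        where
        tail≈0 : ∀ i → c (suc i) ≈ 0#
        tail≈0 = indep (c ∘ suc) (supported-tail supp) λ p → begin
          combination (c ∘ suc) v/ p
            ≈⟨ combination-contract (c ∘ suc) p ⟩
          combination (c ∘ suc) (v ∘ suc) p + - (v zero p * combination (c ∘ suc) (v ∘ suc) u)
            ≈⟨ solve 4 (λ a l b c₀ → a :+ :- (l :* b) := (c₀ :* l :+ a) :+ :- (l :* (c₀ :* con (+ 1) :+ b)))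
                 refl _ _ _ (c zero) ⟩
          combination c v p + - (v zero p * (c zero * 1# + combination (c ∘ suc) (v ∘ suc) u))
            ≈⟨ +-congˡ (-‿cong (*-congˡ (+-congʳ (*-congˡ v₀u≈1)))) ⟨
          combination c v p + - (v zero p * combination c v u)
            ≈⟨ +-cong (vanish p) (-‿cong (*-congˡ (vanish u))) ⟩
          0# + - (v zero p * 0#)
            ≈⟨ solve 1 (λ l → con (+ 0) :+ :- (l :* con (+ 0)) := con (+ 0)) refl (v zero p) ⟩
          0# ∎
        c₀≈0 : c zero ≈ 0#
        c₀≈0 = begin
          c zero                                            ≈⟨ *-identityʳ _ ⟨
          c zero * 1#                                       ≈⟨ *-congˡ v₀u≈1 ⟨
          c zero * v zero u                                 ≈⟨ +-identityʳ _ ⟨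
          c zero * v zero u + 0#
            ≈⟨ +-congˡ (sum-0 {n} (λ i → trans (*-congʳ (tail≈0 i)) (zeroˡ _))) ⟨
          combination c v u                                 ≈⟨ vanish u ⟩
          0#                                                ∎

      inside-independentOn : ∀ {T} → IndependentOn (inside Vec.∷ T) v → IndependentOn T v/
      inside-independentOn indep c supp vanish i =
        -- With this coefficient of `v zero`, the combination of `v` equals the combination of `v/`
        -- at every point.
        indep (- combination c (v ∘ suc) u ∷ c) (supported-inside _ supp)
          (λ p → trans
            (trans (solve 3 (λ a b l → :- b :* l :+ a := a :+ :- (l :* b)) refl _ _ _) (sym (combination-contract c p)))
            (vanish p))
          (suc i)

      -- If v₀ lies in the span of T, a relation that T satisfies after contraction
      -- determines v₀ up to a scalar, so dropping any element i of it leaves an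
      -- independent set.
      independentOn-exchange : ∀ {T c i} → IndependentOn T (v ∘ suc) → Supported T c →
        (∀ p → combination c v/ p ≈ 0#) → ¬ (c i ≈ 0#) → IndependentOn (T - i) v/
      independentOn-exchange {T} {c} {i} indep supp-c vanish-c cᵢ≉0 d supp-d vanish-d =
        indep d d-supp d-vanish
        where
        value : Vector Carrier n → Carrier
        value c = combination c (v ∘ suc) u
        multiple : ∀ c → (∀ p → combination c v/ p ≈ 0#) → ∀ p → combination c (v ∘ suc) p ≈ v zero p * value c
        multiple c vanish p = begin
          combination c (v ∘ suc) p
            ≈⟨ solve 2 (λ a b → a := (a :+ :- b) :+ b) refl _ (v zero p * value c) ⟩
          (combination c (v ∘ suc) p + - (v zero p * value c)) + v zero p * value c
            ≈⟨ +-congʳ (trans (sym (combination-contract c p)) (vanish p)) ⟩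
          0# + v zero p * value c
            ≈⟨ +-identityˡ _ ⟩
          v zero p * value c ∎
        d-supp : Supported T d
        d-supp j j∉T = supp-d j (j∉T ∘ T-i⊆T T i)
        -- Both `c` and `d` combine to scalar multiples of `v zero`. Here the multiples cancel,
        -- which leaves a relation of `T` before contraction.
        e : Vector Carrier n
        e j = value c * d j + - value d * c j
        e≈0 : ∀ j → e j ≈ 0#
        e≈0 = indep e
          (λ j j∉T → trans (+-cong (*-congˡ (d-supp j j∉T)) (*-congˡ (supp-c j j∉T)))
            (solve 2 (λ a b → a :* con (+ 0) :+ b :* con (+ 0) := con (+ 0)) refl (value c) (- value d)))
          (λ p → begin
            sum (λ j → e j * v (suc j) p)
              ≈⟨ sum-cong-≋ {n} (λ j → solve 5 (λ a d b c w → (a :* d :+ b :* c) :* w := a :* (d :* w) :+ b :* (c :* w)) refl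
                   (value c) (d j) (- value d) (c j) (v (suc j) p)) ⟩
            sum (λ j → value c * (d j * v (suc j) p) + - value d * (c j * v (suc j) p))
              ≈⟨ sum-linear {n} (value c) (- value d) _ _ ⟩
            value c * combination d (v ∘ suc) p + - value d * combination c (v ∘ suc) p
              ≈⟨ +-cong (*-congˡ (multiple d vanish-d p)) (*-congˡ (multiple c vanish-c p)) ⟩
            value c * (v zero p * value d) + - value d * (v zero p * value c)
              ≈⟨ solve 3 (λ c l d → c :* (l :* d) :+ :- d :* (l :* c) := con (+ 0)) refl (value c) (v zero p) (value d) ⟩
            0# ∎)
        dᵢ≈0 : d i ≈ 0#
        dᵢ≈0 = supp-d i (i∉T-i T i)
        -- This is coordinate `i` of `e`, where `d i` vanishes and `c i` does not.
        value-d≈0 : value d ≈ 0#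
        value-d≈0 = domain cᵢ≉0 (begin
          c i * value d
            ≈⟨ solve 3 (λ c d a → c :* d := a :* con (+ 0) :+ :- (a :* con (+ 0) :+ :- d :* c))
                 refl (c i) (value d) (value c) ⟩
          value c * 0# + - (value c * 0# + - value d * c i)          ≈⟨ +-congˡ (-‿cong (+-congʳ (*-congˡ dᵢ≈0))) ⟨
          value c * 0# + - e i                                       ≈⟨ +-congˡ (-‿cong (e≈0 i)) ⟩
          value c * 0# + - 0#
            ≈⟨ solve 1 (λ a → a :* con (+ 0) :+ :- con (+ 0) := con (+ 0)) refl (value c) ⟩
          0#                                                         ∎)
        d-vanish : ∀ p → combination d (v ∘ suc) p ≈ 0#
        d-vanish p = trans (multiple d vanish-d p) (trans (*-congˡ value-d≈0) (zeroʳ _))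

      -- An independent set that contains the contracted element loses just that one. A set that
      -- avoids it stays independent under contraction, possibly after one of its elements is given
      -- up. So at most one element is lost.
      isRank-inside : ∀ {S r} → IsRank v/ S r → IsRank v (inside Vec.∷ S) (suc r)
      isRank-inside {S} {r} ((T , T⊆S , indep , ≡.refl) , maximal) =
        (inside Vec.∷ T , in⊆in T⊆S , independentOn-inside indep , ≡.refl) , bound
        where
        bound : ∀ U → U ⊆ inside Vec.∷ S → IndependentOn U v → ∣ U ∣ ℕ.≤ suc r
        bound (inside  Vec.∷ U) U⊆S ind = s≤s (maximal U (drop-∷-⊆ U⊆S) (inside-independentOn ind))
        bound (outside Vec.∷ U) U⊆S ind with em {P = IndependentOn U v/}
        ... | yes ind/ = ℕ.≤-trans (maximal U (drop-∷-⊆ U⊆S) ind/) (ℕ.n≤1+n _)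
        ... | no ¬ind/ with em {P = ∃[ i ] ∣ U ∣ ℕ.≤ suc ∣ U - i ∣ × IndependentOn (U - i) v/}
        ...   | yes (i , U≤ , ind/) = ℕ.≤-trans U≤ (s≤s (maximal (U - i) (drop-∷-⊆ U⊆S ∘ T-i⊆T U i) ind/))
        ...   | no none = contradiction
          (λ c supp vanish i → ≈-dec (c i) λ cᵢ≉0 → none
            (i , ∣T∣≤1+∣T-i∣ U i , independentOn-exchange (outside-independentOn {v = v} ind) supp vanish cᵢ≉0))
          ¬ind/

-- Polynomial functions of one variable

module Univariate (em : ∀ {ℓ} → ExcludedMiddle ℓ) (K : CommutativeRing 0ℓ 0ℓ)
  (inverse : HasInverses K) (char0 : CharacteristicZero K) where

  open CommutativeRing K hiding (zero; _-_)
  open import Data.Vec.Functional using (_∷_)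
  open RawSemiringDefs (RawRing.rawSemiring rawRing) using (_^_; sum) renaming (_×_ to _·_)
  open import Algebra.Properties.Semiring.Sum semiring hiding (sum)
  open import Algebra.Properties.Semiring.Mult semiring using (×1-homo-*)
  open IntegerRingSolver K using (solve; _:+_; _:*_; :-_; _:=_; con)
  open import Relation.Binary.Reasoning.Setoid setoid

  1≉0 : ¬ (1# ≈ 0#)
  1≉0 1≈0 = char0 0 (trans (+-identityʳ 1#) 1≈0)

  open FieldLinearAlgebra em K inverse 1≉0 using (domain; ≈-dec)

  -- Horner form of a polynomial function of degree at most the given number. It permits recursion
  -- on the degree without coefficient vectors, and converts to and from them.
  Deg : ℕ → (Carrier → Carrier) → Set
  Deg zero    F = ∃[ c ] ∀ t → F t ≈ c
  Deg (suc k) F = ∃[ c ] ∃[ G ] Deg k G × (∀ t → F t ≈ c + t * G t)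

  private
    shift-power : ∀ {k} (a : Vector Carrier (suc k)) t →
      sum (λ j → a (suc j) * t ^ toℕ (suc j)) ≈ t * sum (λ j → a (suc j) * t ^ toℕ j)
    shift-power {k} a t = trans
      (sum-cong-≋ {k} (λ j → solve 3 (λ a t p → a :* (t :* p) := t :* (a :* p)) refl (a (suc j)) t (t ^ toℕ j)))
      (sym (*-distribˡ-sum {k} t _))

  coefficients⇒deg : ∀ k {F} → (Σ[ a ∈ Vector Carrier (suc k) ] ∀ t → F t ≈ sum (λ j → a j * t ^ toℕ j)) → Deg k F
  coefficients⇒deg zero    (a , F≈) = a zero , λ t → trans (F≈ t) (trans (+-identityʳ _) (*-identityʳ _))
  coefficients⇒deg (suc k) (a , F≈) = a zero , (λ t → sum (λ j → a (suc j) * t ^ toℕ j)) ,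
    coefficients⇒deg k (a ∘ suc , λ t → refl) ,
    λ t → trans (F≈ t) (+-cong (*-identityʳ _) (shift-power {suc k} a t))

  deg⇒coefficients : ∀ k {F} → Deg k F → Σ[ a ∈ Vector Carrier (suc k) ] ∀ t → F t ≈ sum (λ j → a j * t ^ toℕ j)
  deg⇒coefficients zero    (c , F≈) = const c , λ t → trans (F≈ t) (sym (trans (+-identityʳ _) (*-identityʳ _)))
  deg⇒coefficients (suc k) (c , G , deg-G , F≈) =
    let b , G≈ = deg⇒coefficients k deg-G in
    c ∷ b , λ t → trans (F≈ t) (+-cong (sym (*-identityʳ _))
      (trans (*-congˡ (G≈ t)) (sym (shift-power {suc k} (c ∷ b) t))))

  deg-cong : ∀ k {F G} → (∀ t → F t ≈ G t) → Deg k F → Deg k G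
  deg-cong zero    F≈G (c , F≈)         = c , λ t → trans (sym (F≈G t)) (F≈ t)
  deg-cong (suc k) F≈G (c , H , deg-H , F≈) = c , H , deg-H , λ t → trans (sym (F≈G t)) (F≈ t)

  -- `F` is a bare function between carriers; that it respects `_≈_` has to come from its polynomial
  -- form.
  deg-congruent : ∀ k {F s t} → Deg k F → s ≈ t → F s ≈ F t
  deg-congruent zero    (c , F≈) s≈t = trans (F≈ _) (sym (F≈ _))
  deg-congruent (suc k) (c , G , deg-G , F≈) s≈t =
    trans (F≈ _) (trans (+-congˡ (*-cong s≈t (deg-congruent k deg-G s≈t))) (sym (F≈ _)))

  deg-+ : ∀ k {F G} → Deg k F → Deg k G → Deg k (λ t → F t + G t)
  deg-+ zero    (c , F≈) (d , G≈) = c + d , λ t → +-cong (F≈ t) (G≈ t)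
  deg-+ (suc k) (c , P , deg-P , F≈) (d , Q , deg-Q , G≈) =
    c + d , _ , deg-+ k deg-P deg-Q , λ t → trans (+-cong (F≈ t) (G≈ t))
      (solve 5 (λ c d t p q → (c :+ t :* p) :+ (d :+ t :* q) := (c :+ d) :+ t :* (p :+ q)) refl c d t (P t) (Q t))

  deg-* : ∀ k {F} a → Deg k F → Deg k (λ t → a * F t)
  deg-* zero    a (c , F≈) = a * c , λ t → *-congˡ (F≈ t)
  deg-* (suc k) a (c , G , deg-G , F≈) = a * c , _ , deg-* k a deg-G , λ t → trans (*-congˡ (F≈ t))
    (solve 4 (λ a c t g → a :* (c :+ t :* g) := a :* c :+ t :* (a :* g)) refl a c t (G t))

  deg-const : ∀ k c → Deg k (const c)
  deg-const zero    c = c , λ t → refl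
  deg-const (suc k) c = c , _ , deg-const k 0# , λ t → sym (trans (+-congˡ (zeroʳ t)) (+-identityʳ c))

  deg-mono : ∀ {k m F} → k ℕ.≤ m → Deg k F → Deg m F
  deg-mono {m = m} z≤n (c , F≈) = deg-cong m (λ t → sym (F≈ t)) (deg-const m c)
  deg-mono (s≤s k≤m) (c , G , deg-G , F≈) = c , G , deg-mono k≤m deg-G , F≈

  deg-affine-* : ∀ k {F} α β → Deg k F → Deg (suc k) (λ t → (α + t * β) * F t)
  deg-affine-* k {F} α β deg-F = deg-cong (suc k)
    (λ t → solve 4 (λ α β t f → α :* f :+ (con (+ 0) :+ t :* (β :* f)) := (α :+ t :* β) :* f) refl α β t (F t))
    (deg-+ (suc k) (deg-* (suc k) α (deg-mono (ℕ.n≤1+n k) deg-F))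
      (0# , _ , deg-* k β deg-F , λ t → refl))

  deg-compose : ∀ k {F} α β → Deg k F → Deg k (λ t → F (α + t * β))
  deg-compose zero    α β (c , F≈) = c , λ t → F≈ _
  deg-compose (suc k) α β (c , G , deg-G , F≈) = deg-cong (suc k) (λ t → sym (F≈ (α + t * β)))
    (deg-+ (suc k) (deg-const (suc k) c) (deg-affine-* k α β (deg-compose k α β deg-G)))

  two : Carrier
  two = 2 · 1#

  private
    -- The power is exhibited as at least two units, so that subtracting it from 1 leaves minus a
    -- positive multiple of 1, to which characteristic zero applies.
    two-power : ∀ k → ∃[ m ] two ^ suc k ≈ suc (suc m) · 1#
    two-power zero    = 0 , *-identityʳ two
    two-power (suc k) = let m , p = two-power k in m ℕ.+ suc (suc (m ℕ.+ 0)) , (begin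
      two * two ^ suc k              ≈⟨ *-congˡ p ⟩
      two * suc (suc m) · 1#         ≈⟨ ×1-homo-* 2 (suc (suc m)) ⟨
      (2 ℕ.* suc (suc m)) · 1#       ∎)

    1-two-power≉0 : ∀ k → ¬ (1# + - two ^ suc k ≈ 0#)
    1-two-power≉0 k p = let m , q = two-power k in char0 m (begin
      suc m · 1#
        ≈⟨ solve 1 (λ a → a := :- (con (+ 1) :+ :- (con (+ 1) :+ a))) refl (suc m · 1#) ⟩
      - (1# + - (1# + suc m · 1#))    ≈⟨ -‿cong (+-congˡ (-‿cong q)) ⟨
      - (1# + - two ^ suc k)          ≈⟨ -‿cong p ⟩
      - 0#                            ≈⟨ solve 0 (:- con (+ 0) := con (+ 0)) refl ⟩
      0#                              ∎)

    two≉0 : ¬ (two ≈ 0#)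
    two≉0 = char0 1

    -- Passing from F(s) to F(2s) - 2ᵏ F(s) kills the coefficient of sᵏ.
    deg-doubling : ∀ k {F} → Deg (suc k) F → Deg k (λ s → F (two * s) + - two ^ suc k * F s)
    deg-doubling zero {F} (c , G , (g , G≈) , F≈) = c + - (two * c) , λ s → begin
      F (two * s) + - (two * 1#) * F s
        ≈⟨ +-cong (trans (F≈ (two * s)) (+-congˡ (*-congˡ (G≈ _)))) (*-congˡ (trans (F≈ s) (+-congˡ (*-congˡ (G≈ s))))) ⟩
      (c + two * s * g) + - (two * 1#) * (c + s * g)
        ≈⟨ solve 4 (λ z c s g → (c :+ z :* s :* g) :+ :- (z :* con (+ 1)) :* (c :+ s :* g) := c :+ :- (z :* c))
             refl two c s g ⟩
      c + - (two * c) ∎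
    deg-doubling (suc k) {F} (c , G , deg-G , F≈) =
      c + - two ^ suc (suc k) * c , _ , deg-* k two (deg-doubling k deg-G) , λ s → begin
        F (two * s) + - (two * two ^ suc k) * F s
          ≈⟨ +-cong (F≈ (two * s)) (*-congˡ (F≈ s)) ⟩
        (c + two * s * G (two * s)) + - (two * two ^ suc k) * (c + s * G s)
          ≈⟨ solve 6 (λ z w c s g h → (c :+ z :* s :* h) :+ :- (z :* w) :* (c :+ s :* g) :=
               (c :+ :- (z :* w) :* c) :+ s :* (z :* (h :+ :- w :* g))) refl two (two ^ suc k) c s (G s) (G (two * s)) ⟩
        (c + - two ^ suc (suc k) * c) + s * (two * (G (two * s) + - two ^ suc k * G s)) ∎

  -- The value at 0 of a polynomial of bounded degree is a fixed linear
  -- combination of its values at finitely many nonzero points.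
  value-at-0 : ∀ {a p} {A : Set a} (P : (A → Carrier) → Set p) →
    (∀ {f g} → (∀ x → f x ≈ g x) → P f → P g) →
    (∀ {f g} → P f → P g → P (λ x → f x + g x)) →
    (∀ {f} c → P f → P (λ x → c * f x)) →
    ∀ k (F : Carrier → A → Carrier) → (∀ x → Deg k (λ s → F s x)) →
    (∀ s → ¬ (s ≈ 0#) → P (F s)) → P (F 0#)
  value-at-0 P P-cong P-+ P-* zero F deg-F P-F =
    P-cong (λ x → let c , F≈ = deg-F x in trans (F≈ 1#) (sym (F≈ 0#))) (P-F 1# 1≉0)
  value-at-0 P P-cong P-+ P-* (suc k) F deg-F P-F =
    -- At s = 0 the doubled difference is `1# + - two ^ suc k` times the value of `F`. Its degree in
    -- s is one lower, so the recursion reaches it, and `y` divides the factor out.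
    let y , p = inverse _ (1-two-power≉0 k) in
    P-cong (λ x → begin
        y * (F (two * 0#) x + - two ^ suc k * F 0# x)
          ≈⟨ *-congˡ (+-congʳ (F-0 x)) ⟩
        y * (F 0# x + - two ^ suc k * F 0# x)
          ≈⟨ solve 3 (λ y w f → y :* (f :+ :- w :* f) := ((con (+ 1) :+ :- w) :* y) :* f) refl y (two ^ suc k) (F 0# x) ⟩
        ((1# + - two ^ suc k) * y) * F 0# x
          ≈⟨ trans (*-congʳ p) (*-identityˡ _) ⟩
        F 0# x ∎)
      (P-* y (value-at-0 P P-cong P-+ P-* k (λ s x → F (two * s) x + - two ^ suc k * F s x)
        (λ x → deg-doubling k (deg-F x))
        (λ s s≉0 → P-+ (P-F (two * s) (s≉0 ∘ domain two≉0)) (P-* _ (P-F s s≉0)))))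
    where
    F-0 : ∀ x → F (two * 0#) x ≈ F 0# x
    F-0 x = let c , G , deg-G , F≈ = deg-F x in begin
      F (two * 0#) x                   ≈⟨ F≈ (two * 0#) ⟩
      c + two * 0# * G (two * 0#)      ≈⟨ +-congˡ (trans (*-congʳ (zeroʳ two)) (zeroˡ _)) ⟩
      c + 0#                           ≈⟨ +-congˡ (zeroˡ _) ⟨
      c + 0# * G 0#                    ≈⟨ F≈ 0# ⟨
      F 0# x                           ∎

  deg-zero-at-0 : ∀ k {F} → Deg k F → (∀ s → ¬ (s ≈ 0#) → F s ≈ 0#) → F 0# ≈ 0#
  deg-zero-at-0 k {F} deg-F vanish = value-at-0 {A = Unit} (λ f → f tt ≈ 0#)
    (λ f≈g f≈0 → trans (sym (f≈g tt)) f≈0)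
    (λ f≈0 g≈0 → trans (+-cong f≈0 g≈0) (+-identityˡ 0#))
    (λ c f≈0 → trans (*-congˡ f≈0) (zeroʳ c))
    k (λ s _ → F s) (λ _ → deg-F) vanish

-- Homogeneous functions on the module

module Geometry {m ℓm : Level} (em : ∀ {ℓ} → ExcludedMiddle ℓ) (K : CommutativeRing 0ℓ 0ℓ)
  (inverse : HasInverses K) (char0 : CharacteristicZero K) (V : Module K m ℓm) where

  open CommutativeRing K hiding (zero; _-_)
  open import Data.Vec.Functional using (_∷_; _++_)
  open RawSemiringDefs (RawRing.rawSemiring rawRing) using (sum; product)
  open import Algebra.Properties.Semiring.Sum semiring hiding (sum)
  open IntegerRingSolver K using (solve; _:+_; _:*_; :-_; _:=_; con)
  open import Relation.Binary.Reasoning.Setoid setoid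
  open Univariate em K inverse char0
  open FieldLinearAlgebra em K inverse 1≉0
  open Module V
  open ModuleMorphisms rawModule (TensorUnit.rawModule {R = rawRing})
  open LinearForm using (fun)

  module Form (φ : LinearForm V) = IsModuleHomomorphism (LinearForm.isModuleHomomorphism φ)

  private
    Hom : ℕ → Pred (Carrierᴹ → Carrier) (m ⊔ ℓm)
    Hom = IsHomogeneous V

    fun-line : ∀ φ x t h → fun φ (x +ᴹ t *ₗ h) ≈ fun φ x + t * fun φ h
    fun-line φ x t h = trans (Form.+ᴹ-homo φ x (t *ₗ h)) (+-congˡ (Form.*ₗ-homo φ t h))

  module _ {d : ℕ} {p : Level} (P : Pred (Carrierᴹ → Carrier) p)
    (P-cong : ∀ {f g} → (∀ x → f x ≈ g x) → P f → P g)
    (P-0 : P (const 0#))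
    (P-+ : ∀ {f g} → P f → P g → P (λ x → f x + g x))
    (P-* : ∀ {f} c → P f → P (λ x → c * f x))
    (P-product : ∀ (φ : Fin d → LinearForm V) → P (λ x → product {d} (λ j → fun (φ j) x))) where

    -- Homogeneous functions are by definition linear combinations of products of forms, so a
    -- property stable under linear combinations need only be checked on products.
    hom-elim : ∀ {f} → Hom d f → P f
    hom-elim (k , c , φ , f≈) = P-cong (sym ∘ f≈) (go k c φ)
      where
      go : ∀ k (c : Vector Carrier k) (φ : Fin k → Fin d → LinearForm V) →
           P (λ x → sum (λ i → c i * product (λ j → fun (φ i j) x)))
      go zero    c φ = P-0
      go (suc k) c φ = P-+ (P-* (c zero) (P-product (φ zero))) (go k (c ∘ suc) (φ ∘ suc))

  hom-cong : ∀ {d f g} → (∀ x → f x ≈ g x) → Hom d f → Hom d g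
  hom-cong f≈g (k , c , φ , f≈) = k , c , φ , λ x → trans (sym (f≈g x)) (f≈ x)

  hom-0 : ∀ {d} → Hom d (const 0#)
  hom-0 = 0 , (λ ()) , (λ ()) , λ x → refl

  hom-product : ∀ {d} (φ : Fin d → LinearForm V) → Hom d (λ x → product (λ j → fun (φ j) x))
  hom-product φ = 1 , const 1# , const φ , λ x → sym (trans (+-identityʳ _) (*-identityˡ _))

  hom-+ : ∀ {d f g} → Hom d f → Hom d g → Hom d (λ x → f x + g x)
  hom-+ {d} {f} {g} (k , c , φ , f≈) hom-g = hom-cong (λ x → +-congʳ (sym (f≈ x))) (go k c φ)
    where
    go : ∀ k (c : Vector Carrier k) (φ : Fin k → Fin d → LinearForm V) →
         Hom d (λ x → sum (λ i → c i * product (λ j → fun (φ i j) x)) + g x)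
    go zero    c φ = hom-cong (λ x → sym (+-identityˡ (g x))) hom-g
    go (suc k) c φ = let k′ , c′ , φ′ , eq = go k (c ∘ suc) (φ ∘ suc) in
      suc k′ , c zero ∷ c′ , φ zero ∷ φ′ , λ x → trans (+-assoc _ _ _) (+-congˡ (eq x))

  hom-* : ∀ {d f} a → Hom d f → Hom d (λ x → a * f x)
  hom-* a (k , c , φ , f≈) = k , (λ i → a * c i) , φ , λ x → trans (*-congˡ (f≈ x))
    (trans (*-distribˡ-sum {k} a _) (sum-cong-≋ {k} (λ i → sym (*-assoc a (c i) _))))

  hom-fun-* : ∀ {d f} φ → Hom d f → Hom (suc d) (λ x → fun φ x * f x)
  hom-fun-* φ = hom-elim (λ f → Hom _ (λ x → fun φ x * f x))
    (λ f≈g → hom-cong (λ x → *-congˡ (f≈g x)))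
    (hom-cong (λ x → sym (zeroʳ _)) hom-0)
    (λ hom-f hom-g → hom-cong (λ x → sym (distribˡ _ _ _)) (hom-+ hom-f hom-g))
    (λ c hom-f → hom-cong (λ x → solve 3 (λ c l f → c :* (l :* f) := l :* (c :* f)) refl c (fun φ x) _) (hom-* c hom-f))
    (λ ψ → hom-product (φ ∷ ψ))

  hom-combination : ∀ {d k} c (w : Vector (Carrierᴹ → Carrier) k) → (∀ i → Hom d (w i)) → Hom d (combination c w)
  hom-combination {k = zero}  c w hom-w = hom-0
  hom-combination {k = suc k} c w hom-w =
    hom-+ (hom-* (c zero) (hom-w zero)) (hom-combination (c ∘ suc) (w ∘ suc) (hom-w ∘ suc))

  Congruent : (Carrierᴹ → Carrier) → Set (m ⊔ ℓm)
  Congruent f = ∀ {x y} → x ≈ᴹ y → f x ≈ f y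

  hom⇒congruent : ∀ {d f} → Hom d f → Congruent f
  hom⇒congruent {d} hom-f {x} {y} x≈y = hom-elim (λ f → f x ≈ f y)
    (λ f≈g fx≈fy → trans (sym (f≈g x)) (trans fx≈fy (f≈g y)))
    refl
    (λ p q → +-cong p q)
    (λ c p → *-congˡ p)
    (λ φ → go φ)
    hom-f
    where
    go : ∀ {d} (φ : Fin d → LinearForm V) → product (λ j → fun (φ j) x) ≈ product (λ j → fun (φ j) y)
    go {zero}  φ = refl
    go {suc d} φ = *-cong (Form.⟦⟧-cong (φ zero) x≈y) (go (φ ∘ suc))

  OnLine : ℕ → (Carrierᴹ → Carrier) → Carrierᴹ → Carrierᴹ → Set
  OnLine k f x h = Deg k (λ t → f (x +ᴹ t *ₗ h))

  hom⇒onLine : ∀ {d f} → Hom d f → ∀ x h → OnLine d f x h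
  hom⇒onLine {d} hom-f x h = hom-elim (λ f → OnLine d f x h)
    (λ f≈g → deg-cong d (λ t → f≈g _))
    (deg-const d 0#)
    (deg-+ d)
    (deg-* d)
    (λ φ → go φ)
    hom-f
    where
    go : ∀ {d} (φ : Fin d → LinearForm V) → OnLine d (λ x → product (λ j → fun (φ j) x)) x h
    go {zero}  φ = deg-const 0 1#
    go {suc d} φ = deg-cong (suc d) (λ t → *-congʳ (sym (fun-line (φ zero) x t h)))
      (deg-affine-* d (fun (φ zero) x) (fun (φ zero) h) (go (φ ∘ suc)))

  -- Projection onto a hyperplane and division by its form

  module Projection (l : LinearForm V) (u : Carrierᴹ) (lu≈1 : fun l u ≈ 1#) where
    π : Carrierᴹ → Carrierᴹ
    π x = x +ᴹ (- fun l x) *ₗ u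

    fun-π : ∀ φ x → fun φ (π x) ≈ fun φ x + - (fun l x * fun φ u)
    fun-π φ x = trans (fun-line φ x (- fun l x) u)
      (solve 3 (λ a l b → a :+ :- l :* b := a :+ :- (l :* b)) refl _ _ _)

    l-π : ∀ x → fun l (π x) ≈ 0#
    l-π x = trans (fun-π l x) (trans (+-congˡ (-‿cong (*-congˡ lu≈1)))
      (solve 1 (λ a → a :+ :- (a :* con (+ 1)) := con (+ 0)) refl (fun l x)))

    π-cong : ∀ {x y} → x ≈ᴹ y → π x ≈ᴹ π y
    π-cong x≈y = +ᴹ-cong x≈y (*ₗ-cong (-‿cong (Form.⟦⟧-cong l x≈y)) ≈ᴹ-refl)

    π-line : ∀ x t h → π (x +ᴹ t *ₗ h) ≈ᴹ π x +ᴹ t *ₗ π h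
    π-line x t h = ≈ᴹ-trans
      (+ᴹ-congˡ (≈ᴹ-trans (*ₗ-cong (trans (-‿cong (fun-line l x t h))
          (solve 3 (λ a t b → :- (a :+ t :* b) := :- a :+ t :* :- b) refl (fun l x) t (fun l h))) ≈ᴹ-refl)
        (≈ᴹ-trans (*ₗ-distribʳ u (- fun l x) (t * - fun l h)) (+ᴹ-congˡ (*ₗ-assoc t (- fun l h) u)))))
      (≈ᴹ-trans (interchange x (t *ₗ h) ((- fun l x) *ₗ u) (t *ₗ ((- fun l h) *ₗ u)))
        (+ᴹ-congˡ (≈ᴹ-sym (*ₗ-distribˡ t h ((- fun l h) *ₗ u)))))
      where
      open import Algebra.Properties.CommutativeSemigroup
        (CommutativeMonoid.commutativeSemigroup +ᴹ-commutativeMonoid) using (interchange)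

    restrict : LinearForm V → LinearForm V
    restrict φ = record
      { fun = fun φ ∘ π
      ; isModuleHomomorphism = record
        { isBimoduleHomomorphism = record
          { +ᴹ-isGroupHomomorphism = record
            { isMonoidHomomorphism = record
              { isMagmaHomomorphism = record
                { isRelHomomorphism = record { cong = λ x≈y → Form.⟦⟧-cong φ (π-cong x≈y) }
                ; homo = λ x y → begin
                    fun φ (π (x +ᴹ y))
                      ≈⟨ fun-π φ (x +ᴹ y) ⟩
                    fun φ (x +ᴹ y) + - (fun l (x +ᴹ y) * fun φ u)
                      ≈⟨ +-cong (Form.+ᴹ-homo φ x y) (-‿cong (*-congʳ (Form.+ᴹ-homo l x y))) ⟩
                    (fun φ x + fun φ y) + - ((fun l x + fun l y) * fun φ u)
                      ≈⟨ solve 5 (λ a b c d e → (a :+ b) :+ :- ((c :+ d) :* e) := (a :+ :- (c :* e)) :+ (b :+ :- (d :* e)))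
                           refl (fun φ x) (fun φ y) (fun l x) (fun l y) (fun φ u) ⟩
                    (fun φ x + - (fun l x * fun φ u)) + (fun φ y + - (fun l y * fun φ u))
                      ≈⟨ +-cong (fun-π φ x) (fun-π φ y) ⟨
                    fun φ (π x) + fun φ (π y) ∎
                }
              ; ε-homo = begin
                  fun φ (π 0ᴹ)                          ≈⟨ fun-π φ 0ᴹ ⟩
                  fun φ 0ᴹ + - (fun l 0ᴹ * fun φ u)
                    ≈⟨ +-cong (Form.0ᴹ-homo φ) (-‿cong (*-congʳ (Form.0ᴹ-homo l))) ⟩
                  0# + - (0# * fun φ u)
                    ≈⟨ solve 1 (λ e → con (+ 0) :+ :- (con (+ 0) :* e) := con (+ 0)) refl (fun φ u) ⟩
                  0#                                    ∎
              }
            ; ⁻¹-homo = λ x → begin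
                fun φ (π (-ᴹ x))                              ≈⟨ fun-π φ (-ᴹ x) ⟩
                fun φ (-ᴹ x) + - (fun l (-ᴹ x) * fun φ u)
                  ≈⟨ +-cong (Form.-ᴹ-homo φ x) (-‿cong (*-congʳ (Form.-ᴹ-homo l x))) ⟩
                - fun φ x + - (- fun l x * fun φ u)
                  ≈⟨ solve 3 (λ a c e → :- a :+ :- (:- c :* e) := :- (a :+ :- (c :* e)))
                       refl (fun φ x) (fun l x) (fun φ u) ⟩
                - (fun φ x + - (fun l x * fun φ u))           ≈⟨ -‿cong (fun-π φ x) ⟨
                - fun φ (π x)                                 ∎
            }
          ; *ₗ-homo = λ c x → begin
              fun φ (π (c *ₗ x))                              ≈⟨ fun-π φ (c *ₗ x) ⟩
              fun φ (c *ₗ x) + - (fun l (c *ₗ x) * fun φ u)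
                ≈⟨ +-cong (Form.*ₗ-homo φ c x) (-‿cong (*-congʳ (Form.*ₗ-homo l c x))) ⟩
              c * fun φ x + - (c * fun l x * fun φ u)
                ≈⟨ solve 4 (λ k a c e → k :* a :+ :- (k :* c :* e) := k :* (a :+ :- (c :* e)))
                     refl c (fun φ x) (fun l x) (fun φ u) ⟩
              c * (fun φ x + - (fun l x * fun φ u))           ≈⟨ *-congˡ (fun-π φ x) ⟨
              c * fun φ (π x)                                 ∎
          ; *ᵣ-homo = λ c x → begin
              fun φ (π (x *ᵣ c))                              ≈⟨ fun-π φ (x *ᵣ c) ⟩
              fun φ (x *ᵣ c) + - (fun l (x *ᵣ c) * fun φ u)
                ≈⟨ +-cong (Form.*ᵣ-homo φ c x) (-‿cong (*-congʳ (Form.*ᵣ-homo l c x))) ⟩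
              fun φ x * c + - (fun l x * c * fun φ u)
                ≈⟨ solve 4 (λ k a c e → a :* k :+ :- (c :* k :* e) := (a :+ :- (c :* e)) :* k)
                     refl c (fun φ x) (fun l x) (fun φ u) ⟩
              (fun φ x + - (fun l x * fun φ u)) * c           ≈⟨ *-congʳ (fun-π φ x) ⟨
              fun φ (π x) * c                                 ∎
          }
        }
      }

    hom-restrict : ∀ {d f} → Hom d f → Hom d (f ∘ π)
    hom-restrict (k , c , φ , f≈) = k , c , (λ i j → restrict (φ i j)) , λ x → f≈ (π x)

    -- Division by `l` with the restriction as remainder. Each form satisfies φ(x) = φ(π x) + l(x)
    -- φ(u), and in a product the factors are replaced one at a time, each replacement leaving a
    -- multiple of `l`.
    hom-remainder : ∀ {d f} → Hom (suc d) f → ∃[ g ] Hom d g × (∀ x → f x ≈ f (π x) + fun l x * g x)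
    hom-remainder {d} = hom-elim (λ f → ∃[ g ] Hom d g × (∀ x → f x ≈ f (π x) + fun l x * g x))
      (λ f≈f′ (g , hom-g , eq) → g , hom-g , λ x → trans (sym (f≈f′ x)) (trans (eq x) (+-congʳ (f≈f′ (π x)))))
      (_ , hom-0 , λ x → sym (trans (+-identityˡ _) (zeroʳ _)))
      (λ (g , hom-g , eq) (g′ , hom-g′ , eq′) → _ , hom-+ hom-g hom-g′ , λ x → trans (+-cong (eq x) (eq′ x))
        (solve 5 (λ a b l g h → (a :+ l :* g) :+ (b :+ l :* h) := (a :+ b) :+ l :* (g :+ h)) refl _ _ (fun l x) _ _))
      (λ c (g , hom-g , eq) → _ , hom-* c hom-g , λ x → trans (*-congˡ (eq x))
        (solve 4 (λ c a l g → c :* (a :+ l :* g) := c :* a :+ l :* (c :* g)) refl c _ (fun l x) _))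
      go
      where
      go : ∀ {d} (φ : Fin (suc d) → LinearForm V) → let f x = product (λ j → fun (φ j) x) in
        ∃[ g ] Hom d g × (∀ x → f x ≈ f (π x) + fun l x * g x)
      go {zero} φ = (λ x → fun (φ zero) u * 1#) , (1 , (λ _ → fun (φ zero) u) , (λ _ ()) , λ x → sym (+-identityʳ _)) ,
        λ x → trans
          (solve 3 (λ a l b → a :* con (+ 1) := (a :+ :- (l :* b)) :* con (+ 1) :+ l :* (b :* con (+ 1))) refl
            (fun (φ zero) x) (fun l x) (fun (φ zero) u))
          (+-congʳ (*-congʳ (sym (fun-π (φ zero) x))))
      go {suc d} φ = let g , hom-g , eq = go (φ ∘ suc) ; a = fun (φ zero) in
        (λ x → a x * g x + a u * product (λ j → fun (φ (suc j)) (π x))) ,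
        hom-+ (hom-fun-* (φ zero) hom-g) (hom-* (a u) (hom-restrict (hom-product (φ ∘ suc)))) ,
        λ x → begin
          a x * product (λ j → fun (φ (suc j)) x)
            ≈⟨ *-congˡ (eq x) ⟩
          a x * (product (λ j → fun (φ (suc j)) (π x)) + fun l x * g x)
            ≈⟨ solve 5 (λ a p l g b → a :* (p :+ l :* g) := (a :+ :- (l :* b)) :* p :+ l :* (a :* g :+ b :* p)) refl
                 (a x) (product (λ j → fun (φ (suc j)) (π x))) (fun l x) (g x) (a u) ⟩
          (a x + - (fun l x * a u)) * product (λ j → fun (φ (suc j)) (π x)) +
            fun l x * (a x * g x + a u * product (λ j → fun (φ (suc j)) (π x)))
            ≈⟨ +-congʳ (*-congʳ (fun-π (φ zero) x)) ⟨
          _ ∎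

    hom-0-constant : ∀ {f} → Hom 0 f → ∀ x → f x ≈ f (π x)
    hom-0-constant hom-f x = hom-elim (λ f → f x ≈ f (π x))
      (λ f≈g p → trans (sym (f≈g x)) (trans p (f≈g (π x))))
      refl (λ p q → +-cong p q) (λ c p → *-congˡ p) (λ φ → refl) hom-f

  -- Degree bounds of an arrangement and bases of products of its forms

  private
    count-suc : ∀ {n p k} {P : Pred (Fin (suc n)) p} (P? : Decidable P) (g : Fin k → Fin n) →
      Vec.count P? (Vec.tabulate (suc ∘ g)) ≡ Vec.count (λ i → P? (suc i)) (Vec.tabulate g)
    count-suc {k = zero}  P? g = ≡.refl
    count-suc {k = suc k} P? g =
      ≡.cong (if does (P? (suc (g zero))) then suc else id) (count-suc P? (g ∘ suc))

  ρ-kernel : ∀ {n} (A : Arrangement V (suc n)) h → fun (A zero) h ≈ 0# → ρ A em h ≡ ρ (A ∘ suc) em h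
  ρ-kernel A h lh≈0 with em {P = ¬ (fun (A zero) h ≈ 0#)}
  ... | yes lh≉0 = contradiction lh≈0 lh≉0
  ... | no  _    = count-suc (λ i → em {P = ¬ (forms A i h ≈ 0#)}) (λ i → i)

  ρ-nonkernel : ∀ {n} (A : Arrangement V (suc n)) h → ¬ (fun (A zero) h ≈ 0#) → ρ A em h ≡ suc (ρ (A ∘ suc) em h)
  ρ-nonkernel A h lh≉0 with em {P = ¬ (fun (A zero) h ≈ 0#)}
  ... | yes _    = ≡.cong suc (count-suc (λ i → em {P = ¬ (forms A i h ≈ 0#)}) (λ i → i))
  ... | no  ¬lh≉0 = contradiction lh≉0 ¬lh≉0

  DegreeBound : ∀ {n} → Arrangement V n → Pred (Carrierᴹ → Carrier) (m ⊔ ℓm)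
  DegreeBound A f = ∀ h → ¬ (h ≈ᴹ 0ᴹ) → ∀ x → OnLine (ρ A em h) f x h

  bound-+ : ∀ {n} (A : Arrangement V n) f g → DegreeBound A f → DegreeBound A g → DegreeBound A (λ x → f x + g x)
  bound-+ A f g bound-f bound-g h h≉0 x = deg-+ _ (bound-f h h≉0 x) (bound-g h h≉0 x)

  bound-* : ∀ {n} (A : Arrangement V n) f c → DegreeBound A f → DegreeBound A (λ x → c * f x)
  bound-* A f c bound-f h h≉0 x = deg-* _ c (bound-f h h≉0 x)

  bound-combination : ∀ {n k} (A : Arrangement V n) c (w : Vector (Carrierᴹ → Carrier) k) →
    (∀ i → DegreeBound A (w i)) → DegreeBound A (combination c w)
  bound-combination {k = zero}  A c w bound-w h h≉0 x = deg-const _ 0#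
  bound-combination {k = suc k} A c w bound-w =
    bound-+ A (λ x → c zero * w zero x) (combination (c ∘ suc) (w ∘ suc))
      (bound-* A (w zero) (c zero) (bound-w zero))
      (bound-combination A (c ∘ suc) (w ∘ suc) (bound-w ∘ suc))

  bound-delete : ∀ {n} (A : Arrangement V (suc n)) f → DegreeBound (A ∘ suc) f → DegreeBound A f
  bound-delete A f bound-f h h≉0 x with em {P = fun (A zero) h ≈ 0#}
  ... | yes lh≈0 = deg-mono (ℕ.≤-reflexive (≡.sym (ρ-kernel A h lh≈0))) (bound-f h h≉0 x)
  ... | no  lh≉0 = deg-mono (ℕ.≤-trans (ℕ.n≤1+n _) (ℕ.≤-reflexive (≡.sym (ρ-nonkernel A h lh≉0)))) (bound-f h h≉0 x)

  -- Along a direction in the kernel the new factor is constant on the line and `ρ` does not change;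
  -- along any other direction the degree and `ρ` both grow by one.
  bound-fun-* : ∀ {n} (A : Arrangement V (suc n)) f →
    DegreeBound (A ∘ suc) f → DegreeBound A (λ x → fun (A zero) x * f x)
  bound-fun-* A f bound-f h h≉0 x with em {P = fun (A zero) h ≈ 0#}
  ... | yes lh≈0 = ≡.subst (λ k → Deg k _) (≡.sym (ρ-kernel A h lh≈0))
    (deg-cong _
      (λ t → *-congʳ (sym (trans (fun-line (A zero) x t h)
        (trans (+-congˡ (trans (*-congˡ lh≈0) (zeroʳ t))) (+-identityʳ _)))))
      (deg-* _ (fun (A zero) x) (bound-f h h≉0 x)))
  ... | no  lh≉0 = ≡.subst (λ k → Deg k _) (≡.sym (ρ-nonkernel A h lh≉0))
    (deg-cong (suc (ρ (A ∘ suc) em h)) (λ t → *-congʳ (sym (fun-line (A zero) x t h)))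
      (deg-affine-* (ρ (A ∘ suc) em h) (fun (A zero) x) (fun (A zero) h) (bound-f h h≉0 x)))

  products : ∀ {n} → Arrangement V n → Subset n → Carrierᴹ → Carrier
  products A Vec.[]              x = 1#
  products A (outside Vec.∷ S) x = products (A ∘ suc) S x
  products A (inside  Vec.∷ S) x = fun (A zero) x * products (A ∘ suc) S x

  products-hom : ∀ {n} (A : Arrangement V n) S → Hom ∣ S ∣ (products A S)
  products-hom A Vec.[]            = hom-product (λ ())
  products-hom A (outside Vec.∷ S) = products-hom (A ∘ suc) S
  products-hom A (inside  Vec.∷ S) = hom-fun-* (A zero) (products-hom (A ∘ suc) S)

  products-bound : ∀ {n} (A : Arrangement V n) S → DegreeBound A (products A S)
  products-bound A Vec.[]            h h≉0 x = deg-const (ρ A em h) 1#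
  products-bound A (outside Vec.∷ S) = bound-delete A (products (A ∘ suc) S) (products-bound (A ∘ suc) S)
  products-bound A (inside  Vec.∷ S) = bound-fun-* A (products (A ∘ suc) S) (products-bound (A ∘ suc) S)

  Independent : ∀ {k} → Vector (Carrierᴹ → Carrier) k → Set m
  Independent w = ∀ c → (∀ x → combination c w x ≈ 0#) → ∀ i → c i ≈ 0#

  -- The basis is recorded by subsets and not by functions: read with the restricted forms a subset
  -- gives a basis element of the contraction, and read with the original forms it gives a lift of
  -- that element.
  GradedBasis : ∀ {n} → Arrangement V n → ℕ → ℕ → Set (m ⊔ ℓm)
  GradedBasis {n} A i d = Σ[ B ∈ Vector (Subset n) d ] (∀ j → ∣ B j ∣ ≡ i) × Independent (products A ∘ B) ×
    (∀ f → Hom i f → DegreeBound A f → ∃[ c ] ∀ x → f x ≈ combination c (products A ∘ B) x)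

  +0*ₗ : ∀ x h → x ≈ᴹ x +ᴹ 0# *ₗ h
  +0*ₗ x h = ≈ᴹ-sym (≈ᴹ-trans (+ᴹ-congˡ (*ₗ-zeroˡ h)) (+ᴹ-identityʳ x))

  -- Without forms the bound is 0 in every nonzero direction, so `f` is constant on the line joining
  -- the origin to a nonzero `x`.
  bound-[]-constant : (A : Arrangement V 0) → ∀ {f} → Congruent f → DegreeBound A f → ∀ x → f x ≈ f 0ᴹ
  bound-[]-constant A {f} f-cong bound x with em {P = x ≈ᴹ 0ᴹ}
  ... | yes x≈0 = f-cong x≈0
  ... | no  x≉0 = let c , f≈ = bound x x≉0 0ᴹ in begin
    f x                  ≈⟨ f-cong (≈ᴹ-sym (≈ᴹ-trans (+ᴹ-identityˡ _) (*ₗ-identityˡ x))) ⟩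
    f (0ᴹ +ᴹ 1# *ₗ x)    ≈⟨ f≈ 1# ⟩
    c                    ≈⟨ f≈ 0# ⟨
    f (0ᴹ +ᴹ 0# *ₗ x)    ≈⟨ f-cong (≈ᴹ-sym (+0*ₗ 0ᴹ x)) ⟩
    f 0ᴹ                 ∎

  hom-suc-0 : ∀ {d f} → Hom (suc d) f → f 0ᴹ ≈ 0#
  hom-suc-0 = hom-elim (λ f → f 0ᴹ ≈ 0#)
    (λ f≈g p → trans (sym (f≈g 0ᴹ)) p)
    refl
    (λ p q → trans (+-cong p q) (+-identityˡ 0#))
    (λ c p → trans (*-congˡ p) (zeroʳ c))
    (λ φ → trans (*-congʳ (Form.0ᴹ-homo (φ zero))) (zeroˡ _))

  gradedBasis-[] : (A : Arrangement V 0) → ∀ i → GradedBasis A i (constant i)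
  gradedBasis-[] A zero = const Vec.[] , (λ _ → ≡.refl) ,
    (λ { c vanish zero → trans (sym (trans (+-identityʳ _) (*-identityʳ _))) (vanish 0ᴹ) }) ,
    λ f hom-f bound → const (f 0ᴹ) , λ x →
      trans (bound-[]-constant A (hom⇒congruent hom-f) bound x) (sym (trans (+-identityʳ _) (*-identityʳ _)))
  gradedBasis-[] A (suc i) = (λ ()) , (λ ()) , (λ _ _ ()) ,
    λ f hom-f bound → (λ ()) , λ x → trans (bound-[]-constant A (hom⇒congruent hom-f) bound x) (hom-suc-0 hom-f)

  -- A loop is nonzero in no direction, so `ρ` and with it the whole space are those of the
  -- deletion; the same products serve.
  gradedBasis-loop : ∀ {n} (A : Arrangement V (suc n)) {i d} → (∀ x → fun (A zero) x ≈ 0#) →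
    GradedBasis (A ∘ suc) i d → GradedBasis A i d
  gradedBasis-loop A l≈0 (B , sizes , indep , spans) = (λ j → outside Vec.∷ B j) , sizes , indep ,
    λ f hom-f bound → spans f hom-f λ h h≉0 x →
      ≡.subst (λ k → Deg k _) (ρ-kernel A h (l≈0 h)) (bound h h≉0 x)

  private
    combination-++ : ∀ {a b s} {S : Set s} (p : S → Carrierᴹ → Carrier) (xs : Vector S a) (ys : Vector S b) c x →
      combination c (p ∘ (xs ++ ys)) x ≈
      combination (c ∘ (_↑ˡ b)) (p ∘ xs) x + combination (c ∘ (a ↑ʳ_)) (p ∘ ys) x
    combination-++ {a} {b} p xs ys c x = trans (sum-split a _) (+-cong
      (sum-cong-≋ {a} (λ i → *-congˡ (reflexive (≡.cong (λ S → p S x) (lookup-++ˡ xs ys i)))))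
      (sum-cong-≋ {b} (λ i → *-congˡ (reflexive (≡.cong (λ S → p S x) (lookup-++ʳ xs ys i))))))
      where
      sum-split : ∀ a {b} (f : Vector Carrier (a ℕ.+ b)) → sum f ≈ sum (f ∘ (_↑ˡ b)) + sum (f ∘ (a ↑ʳ_))
      sum-split zero    f = sym (+-identityˡ _)
      sum-split (suc a) f = trans (+-congˡ (sum-split a (f ∘ suc))) (sym (+-assoc _ _ _))

    ↑-cases : ∀ {p} a {b} (P : Fin (a ℕ.+ b) → Set p) → (∀ i → P (i ↑ˡ b)) → (∀ i → P (a ↑ʳ i)) → ∀ i → P i
    ↑-cases a {b} P left right i = ≡.subst P (Fin.join-splitAt a b i)
      ([_,_] {C = λ s → P (join a b s)} left right (splitAt a i))

  -- Deletion and contraction of a nonzero form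

  module NonLoop {n : ℕ} (A : Arrangement V (suc n)) (u : Carrierᴹ) (lu≈1 : fun (A zero) u ≈ 1#) where
    private
      l = fun (A zero)
    open Projection (A zero) u lu≈1

    contraction : Arrangement V n
    contraction i = restrict (A (suc i))

    products-contraction : ∀ S x → products contraction S x ≡ products (A ∘ suc) S (π x)
    products-contraction = go (A ∘ suc)
      where
      go : ∀ {n} (A : Arrangement V n) S x → products (λ i → restrict (A i)) S x ≡ products A S (π x)
      go A Vec.[]            x = ≡.refl
      go A (outside Vec.∷ S) x = go (A ∘ suc) S x
      go A (inside  Vec.∷ S) x = ≡.cong (fun (A zero) (π x) *_) (go (A ∘ suc) S x)

    -- Since the contraction is kept on all of `V`, directions along `u` count as well; `f ∘ π` is
    -- constant in them. Any other line is mapped by `π` to a line whose direction lies in the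
    -- kernel of `l`, where `l` adds nothing to `ρ`.
    bound-restrict : ∀ f → Congruent f → DegreeBound A f → DegreeBound contraction (f ∘ π)
    bound-restrict f f-cong bound h h≉0 x with em {P = π h ≈ᴹ 0ᴹ}
    ... | yes πh≈0 = deg-cong _
      (λ t → f-cong (≈ᴹ-sym (≈ᴹ-trans (π-line x t h)
        (≈ᴹ-trans (+ᴹ-congˡ (≈ᴹ-trans (*ₗ-congˡ πh≈0) (*ₗ-zeroʳ t))) (+ᴹ-identityʳ _)))))
      (deg-const _ (f (π x)))
    ... | no  πh≉0 = ≡.subst (λ k → Deg k _) (ρ-kernel A (π h) (l-π h))
      (deg-cong _ (λ t → f-cong (≈ᴹ-sym (π-line x t h))) (bound (π h) πh≉0 (π x)))

    private
      l-line-u : ∀ x s → l x ≈ 0# → l (x +ᴹ s *ₗ u) ≈ s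
      l-line-u x s lx≈0 = trans (fun-line (A zero) x s u)
        (trans (+-cong lx≈0 (trans (*-congˡ lu≈1) (*-identityʳ s))) (+-identityˡ s))

    -- Multiplication by l is injective on polynomials, as the complement of the
    -- hyperplane is dense on the lines of direction u.
    fun-*-cancel : ∀ {d g} → Hom d g → (∀ x → l x * g x ≈ 0#) → ∀ x → g x ≈ 0#
    fun-*-cancel {d} {g} hom-g lg≈0 x with em {P = l x ≈ 0#}
    ... | no  lx≉0 = domain lx≉0 (lg≈0 x)
    ... | yes lx≈0 = trans (hom⇒congruent hom-g (+0*ₗ x u))
      (deg-zero-at-0 d (hom⇒onLine hom-g x u) λ s s≉0 →
        domain (λ l≈0 → s≉0 (trans (sym (l-line-u x s lx≈0)) l≈0)) (lg≈0 (x +ᴹ s *ₗ u)))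

    -- The converse of `bound-fun-*`, and the reason why a multiple of `l` within the bounds of `A`
    -- comes from the deletion. That `g` is already known to be polynomial is what allows values on
    -- the hyperplane to be recovered from values off it.
    bound-divide : ∀ {d} g → Hom d g → DegreeBound A (λ x → l x * g x) → DegreeBound (A ∘ suc) g
    bound-divide {d} g hom-g bound h h≉0 x with em {P = l h ≈ 0#}
    ... | yes lh≈0 = on-line x
      where
      k = ρ (A ∘ suc) em h
      l-constant : ∀ x t → l (x +ᴹ t *ₗ h) ≈ l x
      l-constant x t = trans (fun-line (A zero) x t h) (trans (+-congˡ (trans (*-congˡ lh≈0) (zeroʳ t))) (+-identityʳ _))
      off-kernel : ∀ x → ¬ (l x ≈ 0#) → OnLine k g x h
      off-kernel x lx≉0 = let y , p = inverse (l x) lx≉0 in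
        deg-cong k
          (λ t → begin
            y * (l (x +ᴹ t *ₗ h) * g (x +ᴹ t *ₗ h))   ≈⟨ *-congˡ (*-congʳ (l-constant x t)) ⟩
            y * (l x * g (x +ᴹ t *ₗ h))
              ≈⟨ solve 3 (λ y l g → y :* (l :* g) := (l :* y) :* g) refl y (l x) _ ⟩
            (l x * y) * g (x +ᴹ t *ₗ h)               ≈⟨ trans (*-congʳ p) (*-identityˡ _) ⟩
            g (x +ᴹ t *ₗ h)                           ∎)
          (deg-* k y (≡.subst (λ k → Deg k _) (ρ-kernel A h lh≈0) (bound h h≉0 x)))
      on-line : ∀ x → OnLine k g x h
      on-line x with em {P = l x ≈ 0#}
      ... | no  lx≉0 = off-kernel x lx≉0
      -- The line lies in the hyperplane. It is the member s = 0 of the family of its translates by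
      -- `s *ₗ u`, the others being off the hyperplane. The dependence on s has degree at most `d`,
      -- so the restriction at s = 0 is a linear combination of restrictions of degree at most `k`.
      ... | yes lx≈0 = deg-cong k (λ t → hom⇒congruent hom-g (+ᴹ-congʳ (≈ᴹ-sym (+0*ₗ x u))))
        (value-at-0 (Deg k) (deg-cong k) (deg-+ k) (deg-* k) d
          (λ s t → g ((x +ᴹ s *ₗ u) +ᴹ t *ₗ h))
          (λ t → deg-cong d (λ s → hom⇒congruent hom-g (swap x (t *ₗ h) (s *ₗ u))) (hom⇒onLine hom-g (x +ᴹ t *ₗ h) u))
          (λ s s≉0 → off-kernel (x +ᴹ s *ₗ u) (λ l≈0 → s≉0 (trans (sym (l-line-u x s lx≈0)) l≈0))))
        where
        swap : ∀ x y z → (x +ᴹ y) +ᴹ z ≈ᴹ (x +ᴹ z) +ᴹ y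
        swap x y z = ≈ᴹ-trans (+ᴹ-assoc x y z) (≈ᴹ-trans (+ᴹ-congˡ (+ᴹ-comm y z)) (≈ᴹ-sym (+ᴹ-assoc x z y)))
    -- Parametrise the line by its distance s from the hyperplane, so that l g
    -- restricts to l(h) s g.
    ... | no  lh≉0 = deg-cong k (λ t → hom⇒congruent hom-g (recentre t)) (deg-compose k (- t₀) 1# centred)
      where
      k = ρ (A ∘ suc) em h
      y = proj₁ (inverse (l h) lh≉0)
      lh*y≈1 = proj₂ (inverse (l h) lh≉0)
      t₀ = - (l x * y)
      x₀ = x +ᴹ t₀ *ₗ h
      lx₀≈0 : l x₀ ≈ 0#
      lx₀≈0 = begin
        l x₀                             ≈⟨ fun-line (A zero) x t₀ h ⟩
        l x + - (l x * y) * l h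
          ≈⟨ solve 3 (λ a y b → a :+ :- (a :* y) :* b := a :+ :- (a :* (b :* y))) refl (l x) y (l h) ⟩
        l x + - (l x * (l h * y))        ≈⟨ +-congˡ (-‿cong (*-congˡ lh*y≈1)) ⟩
        l x + - (l x * 1#)               ≈⟨ solve 1 (λ a → a :+ :- (a :* con (+ 1)) := con (+ 0)) refl (l x) ⟩
        0#                               ∎
      restriction : Deg (suc k) (λ s → l (x₀ +ᴹ s *ₗ h) * g (x₀ +ᴹ s *ₗ h))
      restriction = ≡.subst (λ k → OnLine k (λ x → l x * g x) x₀ h) (ρ-nonkernel A h lh≉0) (bound h h≉0 x₀)
      c = proj₁ restriction
      Q = proj₁ (proj₂ restriction)
      deg-Q = proj₁ (proj₂ (proj₂ restriction))
      lg≈ : ∀ s → s * l h * g (x₀ +ᴹ s *ₗ h) ≈ c + s * Q s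
      lg≈ s = trans (*-congʳ (sym (trans (fun-line (A zero) x₀ s h) (trans (+-congʳ lx₀≈0) (+-identityˡ _)))))
        (proj₂ (proj₂ (proj₂ restriction)) s)
      c≈0 : c ≈ 0#
      c≈0 = begin
        c                                    ≈⟨ +-identityʳ c ⟨
        c + 0#                               ≈⟨ +-congˡ (zeroˡ _) ⟨
        c + 0# * Q 0#                        ≈⟨ lg≈ 0# ⟨
        0# * l h * g (x₀ +ᴹ 0# *ₗ h)         ≈⟨ trans (*-congʳ (zeroˡ _)) (zeroˡ _) ⟩
        0#                                   ∎
      -- The difference between l(h) g and the candidate quotient `Q`. It is killed by s, hence
      -- vanishes for nonzero s, and as a polynomial also at 0; so g is `Q` divided by l(h).
      D : Carrier → Carrier
      D s = l h * g (x₀ +ᴹ s *ₗ h) + - 1# * Q s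
      s*D≈0 : ∀ s → s * D s ≈ 0#
      s*D≈0 s = begin
        s * D s
          ≈⟨ solve 4 (λ s b g q → s :* (b :* g :+ :- con (+ 1) :* q) := s :* b :* g :+ :- (s :* q)) refl s (l h) _ (Q s) ⟩
        s * l h * g (x₀ +ᴹ s *ₗ h) + - (s * Q s)
          ≈⟨ +-congʳ (trans (lg≈ s) (trans (+-congʳ c≈0) (+-identityˡ _))) ⟩
        s * Q s + - (s * Q s)
          ≈⟨ -‿inverseʳ _ ⟩
        0# ∎
      -- Before the conclusion `g` is only known to have degree at most `d` on the line. Any finite
      -- bound suffices for the vanishing of `D` at 0.
      deg-D : Deg (d ℕ.⊔ k) D
      deg-D = deg-+ _ (deg-* _ (l h) (deg-mono (ℕ.m≤m⊔n d k) (hom⇒onLine hom-g x₀ h)))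
        (deg-* _ (- 1#) (deg-mono (ℕ.m≤n⊔m d k) deg-Q))
      D≈0 : ∀ s → D s ≈ 0#
      D≈0 s with em {P = s ≈ 0#}
      ... | no  s≉0 = domain s≉0 (s*D≈0 s)
      ... | yes s≈0 = trans (deg-congruent _ deg-D s≈0)
        (deg-zero-at-0 _ deg-D (λ s s≉0 → domain s≉0 (s*D≈0 s)))
      centred : OnLine k g x₀ h
      centred = deg-cong k
        (λ s → begin
          y * Q s
            ≈⟨ solve 3 (λ y q m → y :* q := y :* (m :+ :- (m :+ :- con (+ 1) :* q)))
                 refl y (Q s) (l h * g (x₀ +ᴹ s *ₗ h)) ⟩
          y * (l h * g (x₀ +ᴹ s *ₗ h) + - D s)
            ≈⟨ *-congˡ (+-congˡ (-‿cong (D≈0 s))) ⟩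
          y * (l h * g (x₀ +ᴹ s *ₗ h) + - 0#)
            ≈⟨ solve 3 (λ y b g → y :* (b :* g :+ :- con (+ 0)) := (b :* y) :* g) refl y (l h) _ ⟩
          (l h * y) * g (x₀ +ᴹ s *ₗ h)
            ≈⟨ trans (*-congʳ lh*y≈1) (*-identityˡ _) ⟩
          g (x₀ +ᴹ s *ₗ h) ∎)
        (deg-* k y deg-Q)
      recentre : ∀ t → x₀ +ᴹ (- t₀ + t * 1#) *ₗ h ≈ᴹ x +ᴹ t *ₗ h
      recentre t = ≈ᴹ-trans (+ᴹ-assoc x _ _) (+ᴹ-congˡ (≈ᴹ-trans (≈ᴹ-sym (*ₗ-distribʳ h t₀ _))
        (*ₗ-congʳ (solve 2 (λ a t → a :+ (:- a :+ t :* con (+ 1)) := t) refl t₀ t))))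

    -- A basis of the kernel of restriction to the hyperplane in degree `i`, made of products that
    -- contain the form `l`.
    KernelBasis : ℕ → ℕ → Set (m ⊔ ℓm)
    KernelBasis i d = Σ[ B ∈ Vector (Subset n) d ] (∀ j → suc ∣ B j ∣ ≡ i) ×
      Independent (λ j → products A (inside Vec.∷ B j)) ×
      (∀ f → Hom i f → DegreeBound A f → (∀ x → f (π x) ≈ 0#) →
        ∃[ c ] ∀ x → f x ≈ combination c (λ j → products A (inside Vec.∷ B j)) x)

    private
      combination-fun-* : ∀ {k} (w : Vector (Carrierᴹ → Carrier) k) c x →
        combination c (λ j x → l x * w j x) x ≈ l x * combination c w x
      combination-fun-* {k} w c x = trans
        (sum-cong-≋ {k} (λ j → solve 3 (λ c l w → c :* (l :* w) := l :* (c :* w)) refl (c j) (l x) (w j x)))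
        (sym (*-distribˡ-sum {k} (l x) _))

    -- A function that vanishes on the hyperplane has remainder zero on division by `l`, and its
    -- quotient lies in the space of the deletion. In degree zero a function equals its restriction,
    -- so the kernel is trivial, which is the value 0 of `shift`.
    kernelBasis : ∀ {d} → (∀ i → GradedBasis (A ∘ suc) i (d i)) → ∀ i → KernelBasis i (shift d i)
    kernelBasis bases zero = (λ ()) , (λ ()) , (λ _ _ ()) ,
      λ f hom-f bound f∘π≈0 → (λ ()) , λ x → trans (hom-0-constant hom-f x) (f∘π≈0 x)
    kernelBasis bases (suc i) = let B , sizes , indep , spans = bases i in
      B , ≡.cong suc ∘ sizes ,
      (λ c vanish → indep c (fun-*-cancel
        (hom-combination c (products (A ∘ suc) ∘ B) (λ j →
          ≡.subst (λ i → Hom i (products (A ∘ suc) (B j))) (sizes j) (products-hom (A ∘ suc) (B j))))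
        (λ x → trans (sym (combination-fun-* (products (A ∘ suc) ∘ B) c x)) (vanish x)))) ,
      λ f hom-f bound f∘π≈0 →
        let g , hom-g , f≈ = hom-remainder hom-f
            f≈lg = λ x → trans (f≈ x) (trans (+-congʳ (f∘π≈0 x)) (+-identityˡ _))
            c , g≈ = spans g hom-g (bound-divide g hom-g (λ h h≉0 x → deg-cong _ (λ t → f≈lg _) (bound h h≉0 x)))
        in c , λ x → trans (f≈lg x) (trans (*-congˡ (g≈ x)) (sym (combination-fun-* (products (A ∘ suc) ∘ B) c x)))

    -- A basis of the kernel of restriction together with lifts of a basis of the contraction. The
    -- lifts use the same subsets, so they obey the bounds of `A` and restriction to the hyperplane
    -- is onto.
    gradedBasis-nonloop : ∀ {i d e} → KernelBasis i d → GradedBasis contraction i e → GradedBasis A i (d ℕ.+ e)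
    gradedBasis-nonloop {i} {d} {e} (B , sizes-B , indep-B , spans-B) (C , sizes-C , indep-C , spans-C) =
      B⁺ ++ C⁺ ,
      ↑-cases d (λ j → ∣ (B⁺ ++ C⁺) j ∣ ≡ i)
        (λ j → ≡.trans (≡.cong ∣_∣ (lookup-++ˡ B⁺ C⁺ j)) (sizes-B j))
        (λ j → ≡.trans (≡.cong ∣_∣ (lookup-++ʳ B⁺ C⁺ j)) (sizes-C j)) ,
      independent , spans
      where
      B⁺ : Vector (Subset (suc n)) d
      B⁺ j = inside Vec.∷ B j
      C⁺ : Vector (Subset (suc n)) e
      C⁺ j = outside Vec.∷ C j

      combination-contraction : ∀ c x →
        combination c (products A ∘ C⁺) (π x) ≈ combination c (products contraction ∘ C) x
      combination-contraction c x = sum-cong-≋ {e} (λ j → *-congˡ (reflexive (≡.sym (products-contraction (C j) x))))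

      kernel-part : ∀ c x → combination c (products A ∘ B⁺) (π x) ≈ 0#
      kernel-part c x = trans (combination-fun-* (products (A ∘ suc) ∘ B) c (π x)) (trans (*-congʳ (l-π x)) (zeroˡ _))

      independent : Independent (products A ∘ (B⁺ ++ C⁺))
      independent c vanish = ↑-cases d (λ i → c i ≈ 0#) B-part C-part
        where
        split = λ x → trans (sym (combination-++ (products A) B⁺ C⁺ c x)) (vanish x)
        -- Composition with `π` kills the products containing `l` and turns the other ones into the
        -- basis of the contraction.
        C-part : ∀ j → c (d ↑ʳ j) ≈ 0#
        C-part = indep-C _ λ x → trans (sym (combination-contraction _ x))
          (trans (sym (trans (+-congʳ (kernel-part _ x)) (+-identityˡ _))) (split (π x)))
        B-part : ∀ j → c (j ↑ˡ e) ≈ 0#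
        B-part = indep-B _ λ x → trans
          (sym (trans (+-congˡ (sum-0 {e} (λ j → trans (*-congʳ (C-part j)) (zeroˡ _)))) (+-identityʳ _))) (split x)

      spans : ∀ f → Hom i f → DegreeBound A f → ∃[ c ] ∀ x → f x ≈ combination c (products A ∘ (B⁺ ++ C⁺)) x
      spans f hom-f bound =
        let b , f∘π≈ = spans-C (f ∘ π) (hom-restrict hom-f) (bound-restrict f (hom⇒congruent hom-f) bound)
            -- The coefficients of the restriction of `f`, with the unrestricted forms: `f` and
            -- `lift` agree on the hyperplane, so their difference lies in the kernel.
            lift = combination b (products A ∘ C⁺)
            hom-lift = hom-combination b (products A ∘ C⁺)
              (λ j → ≡.subst (λ i → Hom i (products A (C⁺ j))) (sizes-C j) (products-hom A (C⁺ j)))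
            bound-lift = bound-combination A b (products A ∘ C⁺) (λ j → products-bound A (C⁺ j))
            a , rest≈ = spans-B (λ x → f x + - 1# * lift x)
              (hom-+ hom-f (hom-* (- 1#) hom-lift))
              (bound-+ A f (λ x → - 1# * lift x) bound (bound-* A lift (- 1#) bound-lift))
              (λ x → trans (+-cong (f∘π≈ x) (*-congˡ (combination-contraction b x)))
                (solve 1 (λ a → a :+ :- con (+ 1) :* a := con (+ 0)) refl _))
        in a ++ b , λ x → begin
          f x
            ≈⟨ solve 2 (λ f g → f := (f :+ :- con (+ 1) :* g) :+ g) refl (f x) (lift x) ⟩
          (f x + - 1# * lift x) + lift x
            ≈⟨ +-congʳ (rest≈ x) ⟩
          combination a (products A ∘ B⁺) x + combination b (products A ∘ C⁺) x
            ≈⟨ +-cong (sum-cong-≋ {d} (λ j → *-congʳ (reflexive (≡.sym (lookup-++ˡ a b j)))))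
                 (sum-cong-≋ {e} (λ j → *-congʳ (reflexive (≡.sym (lookup-++ʳ a b j))))) ⟩
          combination ((a ++ b) ∘ (_↑ˡ e)) (products A ∘ B⁺) x + combination ((a ++ b) ∘ (d ↑ʳ_)) (products A ∘ C⁺) x
            ≈⟨ combination-++ (products A) B⁺ C⁺ (a ++ b) x ⟨
          combination (a ++ b) (products A ∘ (B⁺ ++ C⁺)) x ∎

-- Matroid rank and the induction on the arrangement

private
  subsets-complete : ∀ {n} (T : Subset n) → T ∈ₗ subsets n
  subsets-complete Vec.[]            = Any.here ≡.refl
  subsets-complete (outside Vec.∷ T) = ∈-++⁺ˡ (∈-map⁺ (outside Vec.∷_) (subsets-complete T))
  subsets-complete (inside  Vec.∷ T) = ∈-++⁺ʳ _ (∈-map⁺ (inside Vec.∷_) (subsets-complete T))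

module HilbertSeries {m ℓm : Level} (em : ∀ {ℓ} → ExcludedMiddle ℓ) (K : CommutativeRing 0ℓ 0ℓ)
  (inverse : HasInverses K) (char0 : CharacteristicZero K) (V : Module K m ℓm) where

  open CommutativeRing K hiding (zero; _-_)
  open LaurentRing using (_≋_)
  open TutteRecursion Laurent.rawRing _≋_ (CommutativeRing.isCommutativeRing LaurentRing.commutativeRing)
    Laurent.q Laurent.q⁻¹ (CommutativeRing.refl LaurentRing.commutativeRing)
  open Univariate em K inverse char0
  open FieldLinearAlgebra em K inverse 1≉0
  open Geometry em K inverse char0 V
  open Module V using (Carrierᴹ; _*ₗ_)
  open LinearForm using (fun)

  private
    F = functionModule V

    combination≈ : ∀ {k} c (v : Vector (Carrierᴹ → Carrier) k) x → linearCombination F c v x ≈ combination c v x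
    combination≈ {zero}  c v x = refl
    combination≈ {suc k} c v x = +-congˡ (combination≈ (c ∘ suc) (v ∘ suc) x)

    independentOn⇒ : ∀ {n} {T : Subset n} {v} → LinearlyIndependentOn F T v → IndependentOn T v
    independentOn⇒ {v = v} indep c supp vanish = indep c supp (λ x → trans (combination≈ c v x) (vanish x))

    independentOn⇐ : ∀ {n} {T : Subset n} {v} → IndependentOn T v → LinearlyIndependentOn F T v
    independentOn⇐ {v = v} indep c supp vanish = indep c supp (λ x → trans (sym (combination≈ c v x)) (vanish x))

  module _ {n : ℕ} (A : Arrangement V n) where
    matroidRank-isRank : ∀ S → IsRank (forms A) S (matroidRank A em S)
    matroidRank-isRank S = attained , bound
      where
      P? = λ T → em {P = T ⊆ S × LinearlyIndependentOn F T (forms A)}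
      sizes = List.map ∣_∣ (List.filter P? (subsets n))
      attained : ∃[ T ] T ⊆ S × IndependentOn T (forms A) × ∣ T ∣ ≡ max 0 sizes
      attained with argmax-sel id 0 sizes
      -- If the maximum is the default 0, the empty set attains it.
      ... | inj₁ max≡0 = ⊥ , ⊥⊆ , (λ c supp vanish i → supp i ∉⊥) , ≡.trans (∣⊥∣≡0 n) (≡.sym max≡0)
      ... | inj₂ max∈ with ∈-map⁻ ∣_∣ max∈
      ...   | T , T∈ , max≡∣T∣ = let _ , T⊆S , indep = ∈-filter⁻ P? {xs = subsets n} T∈ in
        T , T⊆S , independentOn⇒ indep , ≡.sym max≡∣T∣
      bound : ∀ T → T ⊆ S → IndependentOn T (forms A) → ∣ T ∣ ℕ.≤ max 0 sizes
      bound T T⊆S indep = All.lookup (xs≤max 0 sizes)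
        (∈-map⁺ ∣_∣ (∈-filter⁺ P? (subsets-complete T) (T⊆S , independentOn⇐ indep)))

    matroidRank≤∣∣ : ∀ S → matroidRank A em S ℕ.≤ ∣ S ∣
    matroidRank≤∣∣ S = let (T , T⊆S , _ , ∣T∣≡) , _ = matroidRank-isRank S in
      ≡.subst (ℕ._≤ ∣ S ∣) ∣T∣≡ (p⊆q⇒∣p∣≤∣q∣ T⊆S)

    module _ {r : ℕ} (hasRank : HasRank A r) where
      private
        basis = proj₁ hasRank
        basis∈span = proj₁ (proj₂ hasRank)
        basis-independent = proj₁ (proj₂ (proj₂ hasRank))
        basis-spans = proj₂ (proj₂ (proj₂ hasRank))

      rank≤n : r ℕ.≤ n
      rank≤n = ≡.subst (ℕ._≤ n) (∣⊤∣≡n r) (steinitz ⊤ basis (forms A)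
        (λ i → let a , eq = basis∈span i in a , λ x → trans (eq x) (combination≈ a (forms A) x))
        (λ c _ vanish → basis-independent c (λ x → trans (combination≈ c basis x) (vanish x))))

      matroidRank≤rank : ∀ S → matroidRank A em S ℕ.≤ r
      matroidRank≤rank S = let (T , _ , indep , ∣T∣≡) , _ = matroidRank-isRank S in
        ≡.subst (ℕ._≤ r) ∣T∣≡ (steinitz T (forms A) basis
          (λ i → let a , eq = basis-spans (forms A i)
                       (indicator i , λ x → sym
                         (trans (combination≈ (indicator i) (forms A) x) (sum-indicator i (λ j → forms A j x))))
                 in a , λ x → trans (eq x) (combination≈ a basis x))
          indep)

  private
    rank-eq : ∀ {n} (A : Arrangement V n) S {r} → IsRank (forms A) S r → matroidRank A em S ≡ r
    rank-eq A S = isRank-unique {v = forms A} (matroidRank-isRank A S)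

    rank-outside : ∀ {n} (A : Arrangement V (suc n)) S → matroidRank A em (outside Vec.∷ S) ≡ matroidRank (A ∘ suc) em S
    rank-outside A S = rank-eq A _ (isRank-outside {v = forms A} (matroidRank-isRank (A ∘ suc) S))

    normalise : ∀ (l : LinearForm V) → ¬ (∀ x → fun l x ≈ 0#) → ∃[ u ] fun l u ≈ 1#
    normalise l l≉0 with em {P = ∃[ x ] ¬ (fun l x ≈ 0#)}
    ... | no  none = contradiction (λ x → ≈-dec _ (λ lx≉0 → none (x , lx≉0))) l≉0
    ... | yes (x , lx≉0) = let y , p = inverse (fun l x) lx≉0 in
      y *ₗ x , trans (Form.*ₗ-homo l y x) (trans (*-comm y _) p)

  -- The truncation `N` is left free beyond `n` because the recursion uses the deletion with one
  -- term fewer than the contraction, although both have the same number of forms.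
  GradedDimensions : ∀ {n} → Arrangement V n → (ℕ → ℕ) → Set _
  GradedDimensions {n} A d = (∀ i → GradedBasis A i (d i)) × (∀ i → n ℕ.< i → d i ≡ 0) ×
    (∀ N → n ℕ.< N → series N d ≋ euler (matroidRank A em))

  gradedDimensions : ∀ {n} (A : Arrangement V n) → ∃[ d ] GradedDimensions A d
  gradedDimensions {zero} A = constant , gradedBasis-[] A , (λ { (suc i) _ → ≡.refl }) ,
    λ { (suc N) _ → L.trans (series-constant N) (L.sym (euler-[] (matroidRank A em))) }
    where module L = CommutativeRing LaurentRing.commutativeRing
  gradedDimensions {suc n} A with em {P = ∀ x → fun (A zero) x ≈ 0#}
  ... | yes l≈0 = let d , bases , vanish , hilb = gradedDimensions (A ∘ suc) in
    d , (λ i → gradedBasis-loop A l≈0 (bases i)) , (λ i n<i → vanish i (ℕ.<⇒≤ n<i)) ,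
    λ N n<N → L.trans (hilb N (ℕ.<⇒≤ n<N)) (L.sym
      (euler-loop (matroidRank A em) (matroidRank (A ∘ suc) em) (matroidRank≤∣∣ (A ∘ suc)) (rank-outside A)
        (λ S → rank-eq A _ (isRank-loop {v = forms A} l≈0 (matroidRank-isRank (A ∘ suc) S)))))
    where module L = CommutativeRing LaurentRing.commutativeRing
  ... | no l≉0 with normalise (A zero) l≉0
  ...   | u , lu≈1 with gradedDimensions (A ∘ suc) | gradedDimensions (NonLoop.contraction A u lu≈1)
  ...     | d , bases , vanish , hilb | e , bases/ , vanish/ , hilb/ =
    (λ i → shift d i ℕ.+ e i) ,
    (λ i → gradedBasis-nonloop (kernelBasis bases i) (bases/ i)) ,
    (λ { (suc i) (s≤s n<i) → ≡.cong₂ ℕ._+_ (vanish i n<i) (vanish/ (suc i) (ℕ.<-trans n<i ℕ.≤-refl)) }) ,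
    λ { (suc N) (s≤s n<N) → L.trans (series-recursion N d e (hilb N n<N) (hilb/ (suc N) (ℕ.<-trans n<N ℕ.≤-refl)))
          (L.sym (euler-nonloop (matroidRank A em) (matroidRank (A ∘ suc) em) (matroidRank contraction em) (rank-outside A)
            (λ S → rank-eq A _ (isRank-inside (matroidRank-isRank contraction S))))) }
    where
    module L = CommutativeRing LaurentRing.commutativeRing
    open NonLoop A u lu≈1
    open Contraction (forms A) u lu≈1 (forms contraction) (λ i → Projection.fun-π (A zero) u lu≈1 (A (suc i)))

  private
    indicator-off : ∀ {n} {i j : Fin n} → ¬ (i ≡ j) → indicator i j ≈ 0#
    indicator-off {i = zero}  {zero}  i≢j = contradiction ≡.refl i≢j
    indicator-off {i = zero}  {suc j} i≢j = refl
    indicator-off {i = suc i} {zero}  i≢j = refl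
    indicator-off {i = suc i} {suc j} i≢j = indicator-off (i≢j ∘ ≡.cong suc)

    hom⇒polynomial : ∀ {i f} → IsHomogeneous V i f → IsPolynomial V f
    hom⇒polynomial {i} {f} hom-f =
      -- All components but the last, of degree `i`, are zero.
      suc i , (λ j x → indicator (fromℕ i) j * f x) , component-hom ,
      λ x → sym (sum-indicator (fromℕ i) (λ _ → f x))
      where
      component-hom : ∀ j → IsHomogeneous V (toℕ j) (λ x → indicator (fromℕ i) j * f x)
      component-hom j with fromℕ i Fin.≟ j
      ... | yes ≡.refl = hom-* _ (≡.subst (λ i → IsHomogeneous V i f) (≡.sym (Fin.toℕ-fromℕ i)) hom-f)
      ... | no  i≢j    = hom-cong (λ x → sym (trans (*-congʳ (indicator-off i≢j)) (zeroˡ _))) hom-0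

  gradedBasis⇒hasDimension : ∀ {n i d} (A : Arrangement V n) → GradedBasis A i d →
    HasDimension F (λ f → C₀ A em f × IsHomogeneous V i f) d
  gradedBasis⇒hasDimension {i = i} A (B , degrees , indep , spans) =
    products A ∘ B ,
    (λ j → (hom⇒polynomial (hom j) , λ h h≉0 x → deg⇒coefficients (ρ A em h) (products-bound A (B j) h h≉0 x)) , hom j) ,
    (λ c vanish → indep c (λ x → trans (sym (combination≈ c (products A ∘ B) x)) (vanish x))) ,
    λ f ((_ , bound) , hom-f) →
      let c , f≈ = spans f hom-f (λ h h≉0 x → coefficients⇒deg (ρ A em h) (bound h h≉0 x))
      in c , λ x → trans (f≈ x) (sym (combination≈ c (products A ∘ B) x))
    where
    hom : ∀ j → IsHomogeneous V i (products A (B j))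
    hom j = ≡.subst (λ i → IsHomogeneous V i (products A (B j))) (degrees j) (products-hom A (B j))

  hilbertSeries : ∀ {n} (A : Arrangement V n) {r} → HasRank A r →
    HasHilbertSeries V (C₀ A em)
      (Laurent.q Laurent.^ (n ∸ r) Laurent.* tutte A em Laurent.rawRing r (Laurent.1# Laurent.+ Laurent.q) Laurent.q⁻¹)
  hilbertSeries {n} A {r} hasRank = let d , bases , vanish , hilb = gradedDimensions A in
    d , suc n , (λ i → gradedBasis⇒hasDimension A (bases i)) , vanish ,
    LaurentRing.≋⇒≈ (L.trans (hilb (suc n) ℕ.≤-refl)
      (L.sym (tutte-euler (matroidRank A em) r (rank≤n A hasRank) (matroidRank≤rank A hasRank) (matroidRank≤∣∣ A))))
    where module L = CommutativeRing LaurentRing.commutativeRing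

open Laurent using (q; q⁻¹; 1#; _+_; _*_; _^_)

corollary4p13 : ∀ {m ℓm} (em : ∀ {ℓ} → ExcludedMiddle ℓ)
    (V : Module ℂ-commutativeRing m ℓm) → FiniteDimensional V →
    ∀ {n : ℕ} (A : Arrangement V n) {r : ℕ} → HasRank A r →
    HasHilbertSeries V (C₀ A em) (q ^ (n ∸ r) * tutte A em Laurent.rawRing r (1# + q) q⁻¹)
corollary4p13 em V _ =
  HilbertSeries.hilbertSeries em ℂ-commutativeRing (ℂ-inverse em) ℂ-characteristic-zero V
  where open ComplexField.ComplexInverse
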